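{- Let $f_n$ be the index, in intersection order, of the first terminal chord of a uniformly random connected chord diagram with $n$ chords. Then $\mathbb E(f_n)\sim \dfrac{2n}{3}$ as $n\to\infty$.
   Context: A chord diagram with $n$ chords is a perfect matching of $\{1,\dots,2n\}$; each pair $\{a,b\}$ with $a<b$ is a chord. The root chord is the chord containing $1$. The oriented intersection graph has a vertex per chord and an edge from $\{a,b\}$ to $\{c,d\}$ whenever $a<c<b<d$. The diagram is connected if this graph is connected (as an undirected graph); a chord is terminal if its vertex has no outgoing edge. The intersection order of the chords of a connected diagram $C$ is defined recursively: the root chord is first; removing the root chord leaves connected components $C_1,\dots,C_s$ (each regarded as a connected chord diagram, endpoints relabeled order-preservingly) ordered by their smallest endpoint; then come all chords of $C_1$ in their intersection order, then those of $C_2$, etc. -}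

module Defs where

open import Data.Bool using (Bool; true; false; _∧_; _∨_; not)
open import Data.Nat using (ℕ; zero; suc; _*_; _<ᵇ_; _≡ᵇ_)
open import Data.Product using (_×_; _,_; proj₁; proj₂)
open import Data.List using (List; []; _∷_; map; concatMap; filterᵇ; length; upTo)
open import Data.Bool.ListAction using (any)
open import Data.Nat.ListAction using (sum)
open import Data.Integer using (+_)
open import Data.Rational using (ℚ; 0ℚ; _/_)

-- A chord is a pair (a , b) with a < b; a chord diagram is a list of chords.
Chord : Set
Chord = ℕ × ℕ

Diagram : Set
Diagram = List Chord

picks : List ℕ → List (ℕ × List ℕ)
picks [] = []
picks (y ∷ ys) = (y , ys) ∷ map (λ p → proj₁ p , y ∷ proj₂ p) (picks ys)

-- all perfect matchings of a (sorted) list into n chords; the smallest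
-- remaining point is matched with each other point in turn.
-- Each matching is produced exactly once, with chords sorted by left endpoint.
matchings : ℕ → List ℕ → List Diagram
matchings zero [] = [] ∷ []
matchings zero (_ ∷ _) = []
matchings (suc n) [] = []
matchings (suc n) (x ∷ xs) =
  concatMap (λ p → map ((x , proj₁ p) ∷_) (matchings n (proj₂ p))) (picks xs)

diagrams : ℕ → List Diagram
diagrams n = matchings n (map suc (upTo (2 * n)))

edge : Chord → Chord → Bool
edge (a , b) (c , d) = (a <ᵇ c) ∧ ((c <ᵇ b) ∧ (b <ᵇ d))

crossing : Chord → Chord → Bool
crossing x y = edge x y ∨ edge y x

chordEq : Chord → Chord → Bool
chordEq (a , b) (c , d) = (a ≡ᵇ c) ∧ (b ≡ᵇ d)

member : Chord → List Chord → Bool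
member x S = any (chordEq x) S

step : Diagram → List Chord → List Chord
step D S = filterᵇ (λ d → member d S ∨ any (crossing d) S) D

iterate : ℕ → Diagram → List Chord → List Chord
iterate zero D S = S
iterate (suc k) D S = iterate k D (step D S)

-- connected component of chord c in D (as a sublist of D, order preserved)
component : Diagram → Chord → List Chord
component D c = iterate (length D) D (c ∷ [])

connected : Diagram → Bool
connected [] = true
connected (c ∷ D) = length (component (c ∷ D) c) ≡ᵇ length (c ∷ D)

-- connected components, ordered by smallest endpoint (lists are kept
-- sorted by left endpoint, so the head has the smallest endpoint); fuel k
components : ℕ → Diagram → List Diagram
components zero _ = []
components (suc k) [] = []
components (suc k) (c ∷ D) =
  component (c ∷ D) c ∷
    components k (filterᵇ (λ d → not (member d (component (c ∷ D) c))) (c ∷ D))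

-- intersection order (root = chord containing the smallest endpoint = head)
intOrder : ℕ → Diagram → List Chord
intOrder zero _ = []
intOrder (suc k) [] = []
intOrder (suc k) (r ∷ D) = r ∷ concatMap (intOrder k) (components (length D) D)

intersectionOrder : Diagram → List Chord
intersectionOrder D = intOrder (length D) D

terminal : Diagram → Chord → Bool
terminal D c = not (any (edge c) D)

-- 1-based index of first element satisfying p (0 if none)
firstIndex : (Chord → Bool) → List Chord → ℕ
firstIndex p [] = 0
firstIndex p (x ∷ xs) with p x
... | true = 1
... | false with firstIndex p xs
...   | zero = 0
...   | suc i = suc (suc i)

firstTerminal : Diagram → ℕ
firstTerminal D = firstIndex (terminal D) (intersectionOrder D)

connectedDiagrams : ℕ → List Diagram
connectedDiagrams n = filterᵇ connected (diagrams n)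

-- a / b as a rational (0 if b = 0)
ratio : ℕ → ℕ → ℚ
ratio a zero = 0ℚ
ratio a (suc b) = (+ a) / suc b

expectedFirstTerminal : ℕ → ℚ
expectedFirstTerminal n =
  ratio (sum (map firstTerminal (connectedDiagrams n))) (length (connectedDiagrams n))

{-# OPTIONS --safe #-}
-- Removing the root of a connected diagram leaves components that are nested around the right end
-- of the root.  Hence a connected diagram D with at least two chords is obtained in exactly one
-- way from connected diagrams A (the first component without the root) and C (the root and all
-- other components) by inserting C, except for its first point, in one of the 2|A| - 1 inner gaps
-- of A.  A chord of A is terminal in D iff it is terminal in A, so f(D) = 1 + f(A), and with c_n
-- the number of connected diagrams and t_n the sum of f over them,
--   c_n = Σ (2k - 1) c_k c_(n-k),   t_n = c_n + Σ (2k - 1) t_k c_(n-k).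
-- Symmetrising gives c_n = (n - 1) Σ c_k c_(n-k), so that for n ≥ 3 c_n lies between 2 (n - 1) c_(n-1) and
-- 2 n c_(n-1).  With w_n = 3 t_n - 2 n c_n the second recurrence becomes
--   w_n = Σ (2k - 1) w_k c_(n-k) + O(c_(n-1)),
-- and since the term k = 1 carries the weight c_(n-1) with w_1 = 1, it follows by induction that
-- w_n = O(c_n), i.e. E(f_n) = 2n/3 + O(1).
module Submission where

open import Defs
open import Data.Bool using (Bool; true; false; T; _∧_; _∨_; not; if_then_else_)
open import Data.Bool.ListAction using (any)
open import Data.Bool.Properties using (T-∧; T-∨; T-≡; T-not-≡)
open import Data.Empty using (⊥; ⊥-elim)
import Data.Integer as ℤ
import Data.Integer.Properties as ℤ
open import Data.List
  using (List; []; _∷_; _++_; map; concatMap; filterᵇ; length; foldr; cartesianProduct; applyUpTo)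
open import Data.List.Properties
  using (length-filter; filter-complete; filter-all; filter-accept; length-map; map-∘; map-cong; map-cong-local;
         map-++; map-applyUpTo; concatMap-map; concatMap-cong; map-concatMap; ∷-injective; ++-assoc; length-++)
open import Data.List.Membership.Propositional using (_∈_; _∉_; find; lose)
open import Data.List.Membership.Propositional.Properties
open import Data.List.Membership.Propositional.Properties.WithK using (unique∧set⇒bag)
open import Data.List.Relation.Binary.BagAndSetEquality using (∼bag⇒↭)
open import Data.List.Relation.Binary.Disjoint.Propositional using (Disjoint)
open import Data.List.Relation.Binary.Permutation.Propositional hiding (trans)
open import Data.List.Relation.Binary.Permutation.Propositional.Properties
  using (All-resp-↭; ∈-resp-↭; ↭-length; drop-∷; ¬x∷xs↭[]; ++⁺; ++⁺ˡ; shift; ++-comm)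
  renaming (map⁺ to ↭-map⁺)
import Data.List.Relation.Binary.Permutation.Setoid.Properties as Permutationₛ
open import Data.List.Relation.Unary.All as All using (All; []; _∷_)
import Data.List.Relation.Unary.All.Properties as All
open import Data.List.Relation.Unary.AllPairs as AllPairs using (AllPairs; []; _∷_)
import Data.List.Relation.Unary.AllPairs.Properties as AllPairs
open import Data.List.Relation.Unary.Any using (here; there; any?)
open import Data.List.Relation.Unary.Any.Properties using (any⁺; any⁻)
open import Data.List.Relation.Unary.Unique.Propositional using (Unique)
import Data.List.Relation.Unary.Unique.Propositional.Properties as Unique
open import Data.Nat
open import Data.Nat.Induction using (<-rec)
open import Data.Nat.ListAction using (sum)
open import Data.Nat.ListAction.Properties using (sum-++; sum-↭)
open import Data.Nat.Properties
open import Data.Nat.Tactic.RingSolver using (solve-∀)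
open import Data.List.Membership.DecPropositional _≟_ using (_∈?_)
open import Data.Product using (_×_; _,_; proj₁; proj₂; ∃-syntax; uncurry)
open import Data.Rational using (ℚ; 0ℚ; 1ℚ)
import Data.Rational as Q
import Data.Rational.Properties as Q
import Data.Rational.Unnormalised as Qᵘ
import Data.Rational.Unnormalised.Properties as Qᵘ
open import Data.Sum as Sum using (_⊎_; inj₁; inj₂; [_,_]′)
open import Function using (_∘_; flip; id; _on_; mk⇔; Equivalence)
open import Relation.Binary.Definitions using (tri<; tri≈; tri>)
open import Relation.Binary.PropositionalEquality
open import Relation.Nullary using (¬_; Dec; yes; no; contradiction)
open import Relation.Nullary.Decidable using (T?; _×-dec_; ¬?; decidable-stable)

open Equivalence using (to; from)

-- Components and connectedness

-- The factor 2/3 comes from an exact cancellation. Writing n = k + (n - k) in 2 n c_n, the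
-- recurrence for w_n acquires the term 3 c_n - 2 Σ (2k - 1) (n - k) c_k c_(n-k), which symmetrising
-- turns into Q - 4 R with Q = Σ c_k c_(n-k) and R = Σ (k - 1) (n - k - 1) c_k c_(n-k). Everything
-- of order c_n is gone; the growth bounds on c_n make Q and R of order c_(n-1). If |w_k| ≤ M c_k
-- for smaller k, then Σ (2k - 1) w_k c_(n-k) is at most M c_n in absolute value, with no room for
-- the error. But w_1 = 1 spares (M - 1) c_(n-1) above and (M + 1) c_(n-1) below; the estimate 4 R ≤
-- 22 c_(n-1) suggests M = 21. Subtraction being truncated on natural numbers, the two sides are
-- separate inductions. The combinatorial half rests on one principle: in a connected diagram, a
-- property that holds for the root and passes along crossings holds for all chords. Most separation
-- arguments consist in choosing that property.

Edge : Chord → Chord → Set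
Edge (a , b) (c , d) = a < c × c < b × b < d

Cross : Chord → Chord → Set
Cross x y = Edge x y ⊎ Edge y x

edge⁻ : ∀ x y → T (edge x y) → Edge x y
edge⁻ (a , b) (c , d) t =
  let p , q = to T-∧ t ; q , r = to T-∧ q in <ᵇ⇒< a c p , <ᵇ⇒< c b q , <ᵇ⇒< b d r

edge⁺ : ∀ x y → Edge x y → T (edge x y)
edge⁺ x y (p , q , r) = from T-∧ (<⇒<ᵇ p , from T-∧ (<⇒<ᵇ q , <⇒<ᵇ r))

crossing⁻ : ∀ x y → T (crossing x y) → Cross x y
crossing⁻ x y = Sum.map (edge⁻ x y) (edge⁻ y x) ∘ to T-∨

crossing⁺ : ∀ x y → Cross x y → T (crossing x y)
crossing⁺ x y = from T-∨ ∘ Sum.map (edge⁺ x y) (edge⁺ y x)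

chordEq⁻ : ∀ x y → T (chordEq x y) → x ≡ y
chordEq⁻ (a , b) (c , d) t = let p , q = to T-∧ t in cong₂ _,_ (≡ᵇ⇒≡ a c p) (≡ᵇ⇒≡ b d q)

chordEq-refl : ∀ x → T (chordEq x x)
chordEq-refl (a , b) = from T-∧ (≡⇒≡ᵇ a a refl , ≡⇒≡ᵇ b b refl)

member⁻ : ∀ {x} S → T (member x S) → x ∈ S
member⁻ {x} S t with y , y∈S , e ← find (any⁻ (chordEq x) S t) rewrite chordEq⁻ x y e = y∈S

member⁺ : ∀ {x S} → x ∈ S → T (member x S)
member⁺ {x} x∈S = any⁺ (chordEq x) (lose x∈S (chordEq-refl x))

keeps : List Chord → Chord → Bool
keeps S d = member d S ∨ any (crossing d) S

step⁻ : ∀ {d} D S → d ∈ step D S → d ∈ D × (d ∈ S ⊎ ∃[ e ] e ∈ S × Cross d e)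
step⁻ {d} D S d∈ =
  let d∈D , t = ∈-filter⁻ (T? ∘ keeps S) {xs = D} d∈
  in d∈D , Sum.map (member⁻ S)
    (λ t → let e , e∈S , x = find (any⁻ (crossing d) S t) in e , e∈S , crossing⁻ d e x) (to T-∨ t)

step⁺ : ∀ {d} D S → d ∈ D → d ∈ S ⊎ (∃[ e ] e ∈ S × Cross d e) → d ∈ step D S
step⁺ {d} D S d∈D h = ∈-filter⁺ (T? ∘ keeps S) d∈D
  (from T-∨ (Sum.map member⁺
    (λ (e , e∈S , x) → any⁺ (crossing d) (lose e∈S (crossing⁺ d e x))) h))

iterate-induction : ∀ (P : Chord → Set) k D S → (∀ {x} → x ∈ S → P x) →
  (∀ {d e} → d ∈ D → P e → Cross d e → P d) → ∀ {x} → x ∈ iterate k D S → P x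
iterate-induction P zero    D S base cl = base
iterate-induction P (suc k) D S base cl = iterate-induction P k D (step D S) base′ cl
  where
  base′ : ∀ {x} → x ∈ step D S → P x
  base′ x∈ with step⁻ D S x∈
  ... | _   , inj₁ x∈S = base x∈S
  ... | x∈D , inj₂ (e , e∈S , c) = cl x∈D (base e∈S) c

component-induction : ∀ (P : Chord → Set) D c → c ∈ D → P c →
  (∀ {d e} → d ∈ D → e ∈ D → P e → Cross d e → P d) →
  ∀ {x} → x ∈ component D c → x ∈ D × P x
component-induction P D c c∈D Pc cl =
  iterate-induction (λ x → x ∈ D × P x) (length D) D (c ∷ [])
    (λ { (here refl) → c∈D , Pc })
    (λ { d∈D (e∈D , Pe) x → d∈D , cl d∈D e∈D Pe x })

component⊆ : ∀ D c → c ∈ D → ∀ {x} → x ∈ component D c → x ∈ D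
component⊆ D c c∈D x∈ = proj₁ (component-induction (_∈ D) D c c∈D c∈D (λ d∈D _ _ _ → d∈D) x∈)

module _ {A : Set} where

  filterᵇ-length-mono : ∀ (p q : A → Bool) xs → (∀ {x} → x ∈ xs → T (p x) → T (q x)) →
    length (filterᵇ p xs) ≤ length (filterᵇ q xs)
  filterᵇ-length-mono p q []       h = z≤n
  filterᵇ-length-mono p q (x ∷ xs) h with p x | q x | h (here refl) | filterᵇ-length-mono p q xs (h ∘ there)
  ... | true  | true  | _ | r = s≤s r
  ... | true  | false | f | r = ⊥-elim (f _)
  ... | false | true  | _ | r = m≤n⇒m≤1+n r
  ... | false | false | _ | r = r

  filterᵇ-length-≡ : ∀ (p q : A → Bool) xs → (∀ {x} → x ∈ xs → T (p x) → T (q x)) →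
    length (filterᵇ p xs) ≡ length (filterᵇ q xs) → filterᵇ p xs ≡ filterᵇ q xs
  filterᵇ-length-≡ p q []       h e = refl
  filterᵇ-length-≡ p q (x ∷ xs) h e
    with p x | q x | h (here refl) | filterᵇ-length-mono p q xs (h ∘ there) | filterᵇ-length-≡ p q xs (h ∘ there)
  ... | true  | true  | _ | _ | r = cong (x ∷_) (r (suc-injective e))
  ... | true  | false | f | _ | r = ⊥-elim (f _)
  ... | false | true  | _ | l | r = ⊥-elim (1+n≰n (subst (_≤ _) e l))
  ... | false | false | _ | _ | r = r e

-- Two nested filters of one list with equal lengths are equal, so for lists of this form it can be
-- read off from lengths that the iteration has stabilised.
Filtered : Diagram → List Chord → Set
Filtered D S = ∃[ p ] S ≡ filterᵇ p D

Closed : Diagram → List Chord → Set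
Closed D S = ∀ {d e} → d ∈ D → e ∈ S → Cross d e → d ∈ S

step-filtered : ∀ D S → Filtered D (step D S)
step-filtered D S = keeps S , refl

step-stable : ∀ D S → Filtered D S → length (step D S) ≡ length S → step D S ≡ S
step-stable D S (p , refl) e = sym (filterᵇ-length-≡ p _ D
  (λ {x} x∈D px → proj₂ (∈-filter⁻ (T? ∘ keeps S) {xs = D}
    (step⁺ D S x∈D (inj₁ (∈-filter⁺ (T? ∘ p) x∈D px))))) (sym e))

step-grows : ∀ D S → Filtered D S → length S ≤ length (step D S)
step-grows D S (p , refl) = filterᵇ-length-mono p _ D
  (λ {x} x∈D px → proj₂ (∈-filter⁻ (T? ∘ keeps S) {xs = D}
    (step⁺ D S x∈D (inj₁ (∈-filter⁺ (T? ∘ p) x∈D px)))))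

iterate-stable : ∀ k D S → step D S ≡ S → iterate k D S ≡ S
iterate-stable zero    D S e = refl
iterate-stable (suc k) D S e rewrite e = iterate-stable k D S e

iterate-filtered : ∀ k D S → Filtered D S → Filtered D (iterate k D S)
iterate-filtered zero    D S f = f
iterate-filtered (suc k) D S f = iterate-filtered k D (step D S) (step-filtered D S)

-- A step either changes nothing, and then the list is closed, or adds at least one chord, so
-- `k + length S` does not decrease. When the fuel runs out, the filter has full length and is all
-- of `D`.
iterate-closed : ∀ k D S → Filtered D S → length D ≤ k + length S → Closed D (iterate k D S)
iterate-closed zero D S (p , refl) l {d} d∈D _ _ =
  subst (d ∈_) (sym (filter-complete (T? ∘ p) (≤-antisym (length-filter (T? ∘ p) D) l))) d∈D
iterate-closed (suc k) D S f l {d} {c} d∈D c∈ x with length (step D S) ≟ length S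
... | yes e = subst (d ∈_) (sym it)
    (subst (d ∈_) st (step⁺ D S d∈D (inj₂ (c , subst (c ∈_) it c∈ , x))))
  where
  st = step-stable D S f e
  it = iterate-stable (suc k) D S st
... | no ne = iterate-closed k D (step D S) (step-filtered D S)
  (≤-trans l (≤-trans (≤-reflexive (sym (+-suc k (length S))))
    (+-monoʳ-≤ k (≤∧≢⇒< (step-grows D S f) (ne ∘ sym))))) d∈D c∈ x

module _ (c : Chord) (D : Diagram) where

  component-filtered : Filtered (c ∷ D) (component (c ∷ D) c)
  component-filtered = iterate-filtered (length D) (c ∷ D) (step (c ∷ D) (c ∷ []))
    (step-filtered (c ∷ D) (c ∷ []))

  private
    root∈step : c ∈ step (c ∷ D) (c ∷ [])
    root∈step = step⁺ (c ∷ D) (c ∷ []) (here refl) (inj₁ (here refl))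

  -- The start `c ∷ []` need not be a filter of the diagram, since `c` might occur again in `D`;
  -- hence the first step is split off. Its result contains `c`, so the remaining `length D` steps
  -- suffice.
  component-closed : Closed (c ∷ D) (component (c ∷ D) c)
  component-closed = iterate-closed (length D) (c ∷ D) (step (c ∷ D) (c ∷ []))
    (step-filtered (c ∷ D) (c ∷ []))
    (≤-trans (≤-reflexive (sym (+-comm (length D) 1))) (+-monoʳ-≤ (length D) (∈-length root∈step)))

  root∈component : c ∈ component (c ∷ D) c
  root∈component = go (suc (length D)) (c ∷ []) (here refl)
    where
    go : ∀ k S → c ∈ S → c ∈ iterate k (c ∷ D) S
    go zero    S c∈ = c∈
    go (suc k) S c∈ = go k (step (c ∷ D) S) (step⁺ (c ∷ D) S (here refl) (inj₁ c∈))

  component-cons : ∃[ p ] component (c ∷ D) c ≡ c ∷ filterᵇ p D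
  component-cons with p , e ← component-filtered
    with proj₂ (∈-filter⁻ (T? ∘ p) {xs = c ∷ D} (subst (c ∈_) e root∈component))
  ... | t = p , trans e (filter-accept (T? ∘ p) t)

-- Connectedness of c ∷ D as an induction principle over its chords.
Connected : Chord → Diagram → Set₁
Connected c D = ∀ (P : Chord → Set) → P c →
  (∀ {d e} → d ∈ c ∷ D → e ∈ c ∷ D → P e → Cross d e → P d) →
  ∀ {d} → d ∈ c ∷ D → P d

-- The test only compares lengths, but a filter of full length is the whole list.
connected⁻ : ∀ c D → T (connected (c ∷ D)) → Connected c D
connected⁻ c D t P Pc cl {d} d∈ with p , e ← component-filtered c D =
  proj₂ (component-induction P (c ∷ D) c (here refl) Pc cl (subst (d ∈_) (sym all) d∈))
  where
  all : component (c ∷ D) c ≡ c ∷ D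
  all = trans e (filter-complete (T? ∘ p)
    (trans (cong length (sym e)) (≡ᵇ⇒≡ _ _ t)))

connected⁺ : ∀ c D → Connected c D → T (connected (c ∷ D))
connected⁺ c D h = ≡⇒≡ᵇ _ _ (trans (cong length (proj₂ f))
  (cong length (filter-all (T? ∘ proj₁ f) (All.tabulate passes))))
  where
  f = component-filtered c D
  passes : ∀ {d} → d ∈ c ∷ D → T (proj₁ f d)
  passes {d} d∈ = proj₂ (∈-filter⁻ (T? ∘ proj₁ f) {xs = c ∷ D} (subst (d ∈_) (proj₂ f)
    (h (_∈ component (c ∷ D) c) (root∈component c D)
       (λ d∈ _ e∈ x → component-closed c D d∈ e∈ x) d∈)))

-- `cl` speaks only about chords of the component, so membership in it is carried along with `P`;
-- closedness renews it at each crossing.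
component-connected : ∀ c D → T (connected (component (c ∷ D) c))
component-connected c D with p , e ← component-cons c D =
  subst (T ∘ connected) (sym e) (connected⁺ c (filterᵇ p D) λ P Pc cl {d} d∈ →
    proj₂ (proj₂ (component-induction (λ x → x ∈ A × P x) (c ∷ D) c (here refl)
      (root∈component c D , Pc)
      (λ {d} {f} d∈D _ (f∈A , Pf) x → let d∈A = component-closed c D d∈D f∈A x in
        d∈A , cl (subst (d ∈_) e d∈A) (subst (f ∈_) e f∈A) Pf x)
      (subst (d ∈_) (sym e) d∈))))
  where
  A = component (c ∷ D) c

Sorted : Diagram → Set
Sorted = AllPairs (λ x y → proj₁ x < proj₁ y)

component-sorted : ∀ c D → Sorted (c ∷ D) → Sorted (component (c ∷ D) c)
component-sorted c D s with p , e ← component-filtered c D =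
  subst Sorted (sym e) (AllPairs.filter⁺ (T? ∘ p) s)

-- Terminal chords and the index of the first one.

terminal⁻ : ∀ D c → T (terminal D c) → ∀ {d} → d ∈ D → ¬ Edge c d
terminal⁻ D c t {d} d∈D x with any (edge c) D | any⁺ (edge c) (lose d∈D (edge⁺ c d x))
... | true | _ = t

terminal⁺ : ∀ D c → (∀ {d} → d ∈ D → ¬ Edge c d) → T (terminal D c)
terminal⁺ D c h with any (edge c) D in eq
... | false = _
... | true with d , d∈D , x ← find (any⁻ (edge c) D (from T-≡ eq)) = h d∈D (edge⁻ c d x)

T-ext : ∀ {a b} → (T a → T b) → (T b → T a) → a ≡ b
T-ext {true}  {true}  _ _ = refl
T-ext {true}  {false} f _ = ⊥-elim (f _)
T-ext {false} {true}  _ g = ⊥-elim (g _)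
T-ext {false} {false} _ _ = refl

firstIndex-cong : ∀ {p q : Chord → Bool} xs → (∀ {x} → x ∈ xs → p x ≡ q x) →
  firstIndex p xs ≡ firstIndex q xs
firstIndex-cong [] h = refl
firstIndex-cong {p} {q} (x ∷ xs) h rewrite h (here refl) with q x
... | true = refl
... | false rewrite firstIndex-cong {p} {q} xs (h ∘ there) = refl

-- The value 0 means that nothing was found, so the hypothesis says that the search succeeds within
-- `xs`.
firstIndex-++ : ∀ p xs ys → 1 ≤ firstIndex p xs → firstIndex p (xs ++ ys) ≡ firstIndex p xs
firstIndex-++ p (x ∷ xs) ys l with p x
... | true = refl
... | false with firstIndex p xs | firstIndex-++ p xs ys
...   | zero  | _ = contradiction l λ ()
...   | suc i | r rewrite r (s≤s z≤n) = refl

firstIndex-skip : ∀ p x xs → p x ≡ false → 1 ≤ firstIndex p xs →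
  firstIndex p (x ∷ xs) ≡ suc (firstIndex p xs)
firstIndex-skip p x xs e l rewrite e with firstIndex p xs
... | suc i = refl

components⊆ : ∀ k D {E x} → E ∈ components k D → x ∈ E → x ∈ D
components⊆ (suc k) (c ∷ D) (here refl) x∈ = component⊆ (c ∷ D) c (here refl) x∈
components⊆ (suc k) (c ∷ D) (there E∈) x∈ =
  proj₁ (∈-filter⁻ (T? ∘ λ d → not (member d (component (c ∷ D) c))) {xs = c ∷ D}
    (components⊆ k _ E∈ x∈))

intOrder⊆ : ∀ k D {x} → x ∈ intOrder k D → x ∈ D
intOrder⊆ (suc k) (r ∷ D) (here refl) = here refl
intOrder⊆ (suc k) (r ∷ D) {x} (there x∈)
  with E , E∈ , x∈E ← find (∈-concatMap⁻ (intOrder k) {xs = components (length D) D} x∈) =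
  there (components⊆ (length D) D E∈ (intOrder⊆ k E x∈E))

-- The fuel is kept as a parameter: a component is processed with more fuel than its length.
firstTerminalFuel : ℕ → Diagram → ℕ
firstTerminalFuel k D = firstIndex (terminal D) (intOrder k D)

-- The order lists the root, then all of `A`. The root is not terminal, and chords of `A` are
-- terminal in `A` and in the whole diagram alike: an edge out of `A` cannot end at the root, whose
-- left end is smallest, nor elsewhere outside `A`, which is closed under crossing.
firstTerminalFuel-step : ∀ k r d D → Sorted (r ∷ d ∷ D) → T (connected (r ∷ d ∷ D)) →
  1 ≤ firstTerminalFuel k (component (d ∷ D) d) →
  firstTerminalFuel (suc k) (r ∷ d ∷ D) ≡ suc (firstTerminalFuel k (component (d ∷ D) d))
firstTerminalFuel-step k r d D (r< ∷ s) con pos = trans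
  (firstIndex-skip (terminal E) r (intOrder k A ++ rest) r-nonterminal (subst (1 ≤_) (sym same) pos))
  (cong suc same)
  where
  E = r ∷ d ∷ D
  A = component (d ∷ D) d
  rest = concatMap (intOrder k) (components (length D)
    (filterᵇ (λ e → not (member e A)) (d ∷ D)))
  r-nonterminal : terminal E r ≡ false
  r-nonterminal with terminal E r in eq
  ... | false = refl
  ... | true = ⊥-elim (<-irrefl (cong proj₁ (sym d≡r)) (All.head r<))
    where
    none : ∀ {e} → e ∈ E → ¬ Edge r e
    none = terminal⁻ E r (from T-≡ eq)
    -- A root without outgoing edges crosses nothing, so being equal to `r` passes along crossings
    -- and reaches `d`.
    d≡r : d ≡ r
    d≡r = connected⁻ r (d ∷ D) con (_≡ r) refl
      (λ { (here refl) _ _ _ → refl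
         ; {e} (there e∈) _ refl (inj₁ x) → ⊥-elim (<-asym (proj₁ x) (All.lookup r< e∈))
         ; (there e∈) _ refl (inj₂ x) → ⊥-elim (none (there e∈) x) })
      (there (here refl))
  terminal-same : ∀ {x} → x ∈ A → terminal E x ≡ terminal A x
  terminal-same {x} x∈A = T-ext
    (λ t → terminal⁺ A x λ y∈A → terminal⁻ E x t (there (component⊆ (d ∷ D) d (here refl) y∈A)))
    (λ t → terminal⁺ E x λ
      { (here refl) e → <-asym (proj₁ e) (All.lookup r< (component⊆ (d ∷ D) d (here refl) x∈A))
      ; (there y∈) e → terminal⁻ A x t (component-closed d D y∈ x∈A (inj₂ e)) e })
  same₀ : firstIndex (terminal E) (intOrder k A) ≡ firstTerminalFuel k A
  same₀ = firstIndex-cong (intOrder k A) (λ x∈ → terminal-same (intOrder⊆ k A x∈))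
  same : firstIndex (terminal E) (intOrder k A ++ rest) ≡ firstTerminalFuel k A
  same = trans (firstIndex-++ (terminal E) (intOrder k A) rest (subst (1 ≤_) (sym same₀) pos)) same₀

-- Positivity is proved along with independence of the fuel because the recursive step needs it for
-- the component. A component is a filter of the tail, so the fuel left after one step is again
-- large enough.
firstTerminalFuel-enough : ∀ k k′ c D → length D < k → length D < k′ →
  Sorted (c ∷ D) → T (connected (c ∷ D)) →
  firstTerminalFuel k (c ∷ D) ≡ firstTerminalFuel k′ (c ∷ D) × 1 ≤ firstTerminalFuel k (c ∷ D)
-- The only possible edge is from the chord to itself, and it evaluates once `a <ᵇ a` is decided.
firstTerminalFuel-enough (suc k) (suc k′) (a , b) [] _ _ _ _ with a <ᵇ a in eq
... | true  = ⊥-elim (<-irrefl refl (<ᵇ⇒< a a (from T-≡ eq)))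
... | false = refl , s≤s z≤n
firstTerminalFuel-enough (suc k) (suc k′) c (d ∷ D) (s≤s l) (s≤s l′) s@(_ ∷ sD) con =
  trans e (cong suc (proj₁ ih)) ◂ e′
  where
  p = proj₁ (component-cons d D)
  cons : component (d ∷ D) d ≡ d ∷ filterᵇ p D
  cons = proj₂ (component-cons d D)
  shorter : length (filterᵇ p D) < suc (length D)
  shorter = s≤s (length-filter (T? ∘ p) D)
  ih : firstTerminalFuel k (component (d ∷ D) d) ≡ firstTerminalFuel k′ (component (d ∷ D) d)
       × 1 ≤ firstTerminalFuel k (component (d ∷ D) d)
  ih rewrite cons = firstTerminalFuel-enough k k′ d (filterᵇ p D)
    (≤-trans shorter l) (≤-trans shorter l′)
    (subst Sorted cons (component-sorted d D sD)) (subst (T ∘ connected) cons (component-connected d D))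
  e : firstTerminalFuel (suc k) (c ∷ d ∷ D) ≡ suc (firstTerminalFuel k (component (d ∷ D) d))
  e = firstTerminalFuel-step k c d D s con (proj₂ ih)
  e′ : firstTerminalFuel (suc k′) (c ∷ d ∷ D) ≡ suc (firstTerminalFuel k′ (component (d ∷ D) d))
  e′ = firstTerminalFuel-step k′ c d D s con (subst (1 ≤_) (proj₁ ih) (proj₂ ih))
  _◂_ : ∀ {x y z : ℕ} → x ≡ suc y → z ≡ suc y → x ≡ z × 1 ≤ x
  _◂_ refl refl = refl , s≤s z≤n

firstTerminal-step : ∀ r d D → Sorted (r ∷ d ∷ D) → T (connected (r ∷ d ∷ D)) →
  firstTerminal (r ∷ d ∷ D) ≡ suc (firstTerminal (component (d ∷ D) d))
firstTerminal-step r d D s@(_ ∷ sD) con with p , e ← component-cons d D =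
  trans (firstTerminalFuel-step (suc (length D)) r d D s con
          (subst (λ A → 1 ≤ firstTerminalFuel (suc (length D)) A) (sym e) (proj₂ enough)))
        (cong suc (trans (cong (firstTerminalFuel (suc (length D))) e)
          (trans (proj₁ enough) (cong firstTerminal (sym e)))))
  where
  enough = firstTerminalFuel-enough (suc (length D)) (suc (length (filterᵇ p D))) d (filterᵇ p D)
    (s≤s (length-filter (T? ∘ p) D)) ≤-refl
    (subst Sorted e (component-sorted d D sD)) (subst (T ∘ connected) e (component-connected d D))

-- Matchings of a list of points

points : Diagram → List ℕ
points []            = []
points ((a , b) ∷ D) = a ∷ b ∷ points D

points-++ : ∀ D E → points (D ++ E) ≡ points D ++ points E
points-++ []            E = refl
points-++ ((a , b) ∷ D) E = cong (λ l → a ∷ b ∷ l) (points-++ D E)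

points-↭ : ∀ {D E} → D ↭ E → points D ↭ points E
points-↭ refl = ↭-refl
points-↭ (prep (a , b) p) = prep a (prep b (points-↭ p))
points-↭ (swap (a , b) (c , d) p) = begin
  a ∷ b ∷ c ∷ d ∷ _ ↭⟨ prep a (swap b c ↭-refl) ⟩
  a ∷ c ∷ b ∷ d ∷ _ ↭⟨ swap a c (swap b d ↭-refl) ⟩
  c ∷ a ∷ d ∷ b ∷ _ ↭⟨ prep c (swap a d ↭-refl) ⟩
  c ∷ d ∷ a ∷ b ∷ _ ↭⟨ prep c (prep d (prep a (prep b (points-↭ p)))) ⟩
  c ∷ d ∷ a ∷ b ∷ _ ∎
  where open PermutationReasoning
points-↭ (_↭_.trans p q) = ↭-trans (points-↭ p) (points-↭ q)

length-points : ∀ D → length (points D) ≡ 2 * length D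
length-points []      = refl
length-points (_ ∷ D) = cong suc (trans (cong suc (length-points D)) (sym (+-suc (length D) (length D + 0))))

left∈points : ∀ {a b D} → (a , b) ∈ D → a ∈ points D
left∈points (here refl) = here refl
left∈points (there x∈)  = there (there (left∈points x∈))

right∈points : ∀ {a b D} → (a , b) ∈ D → b ∈ points D
right∈points (here refl) = there (here refl)
right∈points (there x∈)  = there (there (right∈points x∈))

points⁻ : ∀ {p} D → p ∈ points D → ∃[ a ] ∃[ b ] (a , b) ∈ D × (p ≡ a ⊎ p ≡ b)
points⁻ ((a , b) ∷ D) (here e)         = a , b , here refl , inj₁ e
points⁻ ((a , b) ∷ D) (there (here e)) = a , b , here refl , inj₂ e
points⁻ ((a , b) ∷ D) (there (there p∈)) with c , d , x∈ , e ← points⁻ D p∈ = c , d , there x∈ , e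

Ascending : Chord → Set
Ascending (a , b) = a < b

-- Describes the members of `matchings` without its recursion: over distinct points `perm` says that
-- each is used exactly once, and the two order conditions select one list per matching.
record IsMatching (xs : List ℕ) (D : Diagram) : Set where
  constructor isMatching
  field
    sorted    : Sorted D
    ascending : All Ascending D
    perm      : points D ↭ xs

picks⁻ : ∀ {y ys} xs → (y , ys) ∈ picks xs → y ∷ ys ↭ xs
picks⁻ (x ∷ xs) (here refl) = ↭-refl
picks⁻ (x ∷ xs) (there y∈) with (y , ys) , y∈′ , refl ← ∈-map⁻ _ y∈ =
  ↭-trans (swap y x ↭-refl) (prep x (picks⁻ xs y∈′))

picks⁺ : ∀ {y} xs → y ∈ xs → ∃[ ys ] (y , ys) ∈ picks xs
picks⁺ (x ∷ xs) (here refl) = xs , here refl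
picks⁺ (x ∷ xs) (there y∈) with ys , e ← picks⁺ xs y∈ = x ∷ ys , there (∈-map⁺ _ e)

picks-increasing : ∀ {y ys} xs → AllPairs _<_ xs → (y , ys) ∈ picks xs → AllPairs _<_ ys
picks-increasing (x ∷ xs) (_ ∷ s) (here refl) = s
picks-increasing (x ∷ xs) (x< ∷ s) (there y∈) with (y , ys) , y∈′ , refl ← ∈-map⁻ _ y∈ =
  All.tail (All-resp-↭ (↭-sym (picks⁻ xs y∈′)) x<) ∷ picks-increasing xs s y∈′

map-proj₁-picks : ∀ xs → map proj₁ (picks xs) ≡ xs
map-proj₁-picks []       = refl
map-proj₁-picks (x ∷ xs) =
  cong (x ∷_) (trans (sym (map-∘ (picks xs))) (map-proj₁-picks xs))

matchings⁻ : ∀ n xs {D} → AllPairs _<_ xs → D ∈ matchings n xs → length D ≡ n × IsMatching xs D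
matchings⁻ zero [] s (here refl) = refl , isMatching [] [] ↭-refl
matchings⁻ (suc n) (x ∷ xs) (x< ∷ s) D∈
  with (y , ys) , y∈ , D∈′ ← find (∈-concatMap⁻ _ {xs = picks xs} D∈)
  with E , E∈ , refl ← ∈-map⁻ ((x , y) ∷_) D∈′
  with l , isMatching sE aE pE ← matchings⁻ n ys (picks-increasing xs s y∈) E∈ =
  cong suc l , isMatching
    (All.tabulate (λ z∈ → All.lookup x<ys (∈-resp-↭ pE (left∈points z∈))) ∷ sE)
    (All.head x<yys ∷ aE)
    (prep x (↭-trans (prep y pE) (picks⁻ xs y∈)))
  where
  x<yys = All-resp-↭ (↭-sym (picks⁻ xs y∈)) x<
  x<ys = All.tail x<yys

sorted⇒head-minimal : ∀ {a b D} → Sorted ((a , b) ∷ D) → All Ascending ((a , b) ∷ D) →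
  ∀ {p} → p ∈ points ((a , b) ∷ D) → a ≤ p
sorted⇒head-minimal {a} {b} {D} (a< ∷ s) (a<b ∷ as) p∈ with points⁻ ((a , b) ∷ D) p∈
... | c , d , here refl , inj₁ refl = ≤-refl
... | c , d , here refl , inj₂ refl = <⇒≤ a<b
... | c , d , there x∈  , inj₁ refl = <⇒≤ (All.lookup a< x∈)
... | c , d , there x∈  , inj₂ refl = <⇒≤ (<-trans (All.lookup a< x∈) (All.lookup as x∈))

matchings⁺ : ∀ n xs {D} → AllPairs _<_ xs → length D ≡ n → IsMatching xs D → D ∈ matchings n xs
matchings⁺ zero [] {[]} s l m = here refl
matchings⁺ zero (x ∷ xs) {[]} s l m = ⊥-elim (¬x∷xs↭[] (↭-sym (IsMatching.perm m)))
matchings⁺ (suc n) [] {(a , b) ∷ D} s l m = ⊥-elim (¬x∷xs↭[] (IsMatching.perm m))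
matchings⁺ (suc n) (x ∷ xs) {(a , b) ∷ D} (x< ∷ s) l (isMatching sD@(_ ∷ sD′) aD@(_ ∷ aD′) p)
  -- `a` and `x` are both the least element of the same set of points.
  with ≤-antisym (sorted⇒head-minimal sD aD (∈-resp-↭ (↭-sym p) (here refl)))
                 (x≤ (∈-resp-↭ p (here refl)))
  where
  x≤ : ∀ {z} → z ∈ x ∷ xs → x ≤ z
  x≤ (here refl) = ≤-refl
  x≤ (there z∈)  = <⇒≤ (All.lookup x< z∈)
... | refl with p′ ← drop-∷ p
  with ys , b∈ ← picks⁺ xs (∈-resp-↭ p′ (here refl)) =
  ∈-concatMap⁺ _ (lose b∈ (∈-map⁺ _ (matchings⁺ n ys (picks-increasing xs s b∈) (suc-injective l)
    (isMatching sD′ aD′ (drop-∷ (↭-trans p′ (↭-sym (picks⁻ xs b∈))))))))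

concatMap-unique : ∀ {A B : Set} (f : A → List B) xs → (∀ {x} → x ∈ xs → Unique (f x)) →
  AllPairs (λ x y → Disjoint (f x) (f y)) xs → Unique (concatMap f xs)
concatMap-unique f xs u d = Unique.concat⁺ (All.map⁺ (All.tabulate u)) (AllPairs.map⁺ d)

-- Different partners of `x` give different first chords, and the partners are distinct because
-- `picks` takes every point of `xs` once.
matchings-unique : ∀ n xs → AllPairs _<_ xs → Unique (matchings n xs)
matchings-unique zero    []       s = [] ∷ []
matchings-unique zero    (x ∷ xs) s = []
matchings-unique (suc n) []       s = []
matchings-unique (suc n) (x ∷ xs) (_ ∷ s) = concatMap-unique _ (picks xs)
  (λ y∈ → Unique.map⁺ (proj₂ ∘ ∷-injective) (matchings-unique n _ (picks-increasing xs s y∈)))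
  (AllPairs.map disjoint (AllPairs.map⁻ (subst Unique (sym (map-proj₁-picks xs)) (AllPairs.map <⇒≢ s))))
  where
  disjoint : ∀ {p q : ℕ × List ℕ} → proj₁ p ≢ proj₁ q →
    Disjoint (map ((x , proj₁ p) ∷_) (matchings n (proj₂ p))) (map ((x , proj₁ q) ∷_) (matchings n (proj₂ q)))
  disjoint ne (D∈ , D∈′) with _ , _ , refl ← ∈-map⁻ _ D∈ with _ , _ , e ← ∈-map⁻ _ D∈′ =
    ne (cong proj₂ (proj₁ (∷-injective e)))

open IsMatching

-- Joining two connected diagrams

unique∧sets⇒↭ : ∀ {A : Set} {xs ys : List A} → Unique xs → Unique ys →
  (∀ {x} → x ∈ xs → x ∈ ys) → (∀ {x} → x ∈ ys → x ∈ xs) → xs ↭ ys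
unique∧sets⇒↭ u v f g = ∼bag⇒↭ (unique∧set⇒bag u v (mk⇔ f g))

Unique-resp-↭ : ∀ {A : Set} {xs ys : List A} → xs ↭ ys → Unique xs → Unique ys
Unique-resp-↭ p = Permutationₛ.Unique-resp-↭ (setoid _) (↭⇒↭ₛ p)

Unique-++⁻ : ∀ {A : Set} (xs : List A) {ys} → Unique (xs ++ ys) → Unique xs × Unique ys × Disjoint xs ys
Unique-++⁻ []       u        = [] , u , λ ()
Unique-++⁻ (x ∷ xs) (x∉ ∷ u) with u₁ , u₂ , d ← Unique-++⁻ xs u =
  All.++⁻ˡ xs x∉ ∷ u₁ , u₂ , λ
    { (here refl , z∈ys) → All.lookup (All.++⁻ʳ xs x∉) z∈ys refl
    ; (there z∈xs , z∈ys) → d (z∈xs , z∈ys) }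

-- Strictly increasing left ends leave only one order, so diagrams can be compared as sets of
-- chords. This is how results of `join` and `component` are identified.
sorted-ext : ∀ {D E} → Sorted D → Sorted E →
  (∀ {x} → x ∈ D → x ∈ E) → (∀ {x} → x ∈ E → x ∈ D) → D ≡ E
sorted-ext {[]}    {[]}    _ _ f g = refl
sorted-ext {[]}    {y ∷ E} _ _ f g with () ← g (here refl)
sorted-ext {x ∷ D} {[]}    _ _ f g with () ← f (here refl)
sorted-ext {x ∷ D} {y ∷ E} (x< ∷ s) (y< ∷ t) f g with heads (f (here refl)) (g (here refl))
  where
  heads : x ∈ y ∷ E → y ∈ x ∷ D → x ≡ y
  heads (here e)   _          = e
  heads (there x∈) (here e)   = sym e
  heads (there x∈) (there y∈) = ⊥-elim (<-asym (All.lookup x< y∈) (All.lookup y< x∈))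
... | refl = cong (x ∷_) (sorted-ext s t (λ z∈ → tail x< z∈ (f (there z∈))) (λ z∈ → tail y< z∈ (g (there z∈))))
  where
  tail : ∀ {z F G} → All (λ y → proj₁ x < proj₁ y) F → z ∈ F → z ∈ x ∷ G → z ∈ G
  tail x< z∈ (here refl) = ⊥-elim (<-irrefl refl (All.lookup x< z∈))
  tail x< z∈ (there z∈′) = z∈′

insert : Chord → Diagram → Diagram
insert x []      = x ∷ []
insert x (y ∷ D) = if proj₁ x <ᵇ proj₁ y then x ∷ y ∷ D else y ∷ insert x D

insert-↭ : ∀ x D → insert x D ↭ x ∷ D
insert-↭ x []      = ↭-refl
insert-↭ x (y ∷ D) with proj₁ x <ᵇ proj₁ y
... | true  = ↭-refl
... | false = ↭-trans (prep y (insert-↭ x D)) (swap y x ↭-refl)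

insert-sorted : ∀ x D → Sorted D → (∀ {y} → y ∈ D → proj₁ x ≢ proj₁ y) → Sorted (insert x D)
insert-sorted x []      s        ne = [] ∷ []
insert-sorted x (y ∷ D) (y< ∷ s) ne with proj₁ x <ᵇ proj₁ y in eq
... | true = (x<y ∷ All.map (<-trans x<y) y<) ∷ y< ∷ s
  where x<y = <ᵇ⇒< (proj₁ x) (proj₁ y) (from T-≡ eq)
... | false = All-resp-↭ (↭-sym (insert-↭ x D)) (y<x ∷ y<) ∷ insert-sorted x D s (ne ∘ there)
  where
  y<x : proj₁ y < proj₁ x
  y<x = ≤∧≢⇒< (≮⇒≥ (λ x<y → subst T eq (<⇒<ᵇ x<y))) (ne (here refl) ∘ sym)

-- Insertion rather than concatenation, because diagrams are sorted by left endpoint and the left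
-- ends of the two pieces may interleave.
join : Diagram → Diagram → Diagram
join A C = foldr insert C A

join-↭ : ∀ A C → join A C ↭ A ++ C
join-↭ []      C = ↭-refl
join-↭ (x ∷ A) C = ↭-trans (insert-↭ x (join A C)) (prep x (join-↭ A C))

join⁻ : ∀ A C {x} → x ∈ join A C → x ∈ A ⊎ x ∈ C
join⁻ A C = ∈-++⁻ A ∘ ∈-resp-↭ (join-↭ A C)

join⁺ˡ : ∀ A C {x} → x ∈ A → x ∈ join A C
join⁺ˡ A C = ∈-resp-↭ (↭-sym (join-↭ A C)) ∘ ∈-++⁺ˡ

join⁺ʳ : ∀ A C {x} → x ∈ C → x ∈ join A C
join⁺ʳ A C = ∈-resp-↭ (↭-sym (join-↭ A C)) ∘ ∈-++⁺ʳ A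

join-sorted : ∀ A C → Sorted A → Sorted C → (∀ {x y} → x ∈ A → y ∈ C → proj₁ x ≢ proj₁ y) →
  Sorted (join A C)
join-sorted []      C sA        sC ne = sC
join-sorted (x ∷ A) C (x< ∷ sA) sC ne = insert-sorted x (join A C)
  (join-sorted A C sA sC (ne ∘ there))
  (λ y∈ → [ <⇒≢ ∘ All.lookup x< , ne (here refl) ]′ (join⁻ A C y∈))

join-root : ∀ A r C → All (λ x → proj₁ r < proj₁ x) A → join A (r ∷ C) ≡ r ∷ join A C
join-root []      r C []         = refl
join-root (x ∷ A) r C (r<x ∷ r<) rewrite join-root A r C r< with proj₁ x <ᵇ proj₁ r in eq
... | true  = ⊥-elim (<-asym r<x (<ᵇ⇒< (proj₁ x) (proj₁ r) (from T-≡ eq)))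
... | false = refl

range : ℕ → ℕ → List ℕ
range a zero    = []
range a (suc m) = a ∷ range (suc a) m

length-range : ∀ a m → length (range a m) ≡ m
length-range a zero    = refl
length-range a (suc m) = cong suc (length-range (suc a) m)

range⁻ : ∀ {x} a m → x ∈ range a m → a ≤ x × x < a + m
range⁻ a (suc m) (here refl) = ≤-refl , m<m+n a (s≤s z≤n)
range⁻ a (suc m) (there x∈) with p , q ← range⁻ (suc a) m x∈ =
  <⇒≤ p , <-≤-trans q (≤-reflexive (sym (+-suc a m)))

range⁺ : ∀ {x} a m → a ≤ x → x < a + m → x ∈ range a m
range⁺ a zero    p q = ⊥-elim (<⇒≱ q (≤-trans (≤-reflexive (+-identityʳ a)) p))
range⁺ a (suc m) p q with m≤n⇒m<n∨m≡n p
... | inj₁ a<x  = there (range⁺ (suc a) m a<x (<-≤-trans q (≤-reflexive (+-suc a m))))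
... | inj₂ refl = here refl

range-increasing : ∀ a m → AllPairs _<_ (range a m)
range-increasing a zero    = []
range-increasing a (suc m) = All.tabulate (λ x∈ → proj₁ (range⁻ (suc a) m x∈)) ∷ range-increasing (suc a) m

range-++ : ∀ a m n → range a (m + n) ≡ range a m ++ range (a + m) n
range-++ a zero    n rewrite +-identityʳ a = refl
range-++ a (suc m) n rewrite +-suc a m = cong (a ∷_) (range-++ (suc a) m n)

-- In the decomposition of a diagram on 1, …, 1 + g + m + e, the first component A of the diagram
-- without its root occupies the g points after 1 and the e last points; C has the other points.
outer : ℕ → ℕ → ℕ → List ℕ
outer g m e = range 2 g ++ range (2 + g + m) e

inner : ℕ → ℕ → List ℕ
inner g m = 1 ∷ range (2 + g) m

outer⁻ : ∀ {p} g m e → p ∈ outer g m e → 2 ≤ p × (p < 2 + g ⊎ 2 + g + m ≤ p) × p < 2 + g + m + e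
outer⁻ g m e p∈ with ∈-++⁻ (range 2 g) p∈
... | inj₁ q with l , u ← range⁻ 2 g q =
  l , inj₁ u , <-≤-trans u (≤-trans (m≤m+n (2 + g) m) (m≤m+n (2 + g + m) e))
... | inj₂ q with l , u ← range⁻ (2 + g + m) e q = ≤-trans (s≤s (s≤s z≤n)) l , inj₂ l , u

outer-increasing : ∀ g m e → AllPairs _<_ (outer g m e)
outer-increasing g m e = AllPairs.++⁺ (range-increasing 2 g) (range-increasing (2 + g + m) e)
  (All.tabulate λ x∈ → All.tabulate λ y∈ → <-≤-trans (proj₂ (range⁻ 2 g x∈))
    (≤-trans (m≤m+n (2 + g) m) (proj₁ (range⁻ (2 + g + m) e y∈))))

inner-increasing : ∀ g m → AllPairs _<_ (inner g m)
inner-increasing g m =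
  All.tabulate (λ x∈ → ≤-trans (s≤s (s≤s z≤n)) (proj₁ (range⁻ (2 + g) m x∈))) ∷ range-increasing (2 + g) m

outer++inner : ∀ g m e → outer g m e ++ inner g m ↭ range 1 (1 + g + m + e)
outer++inner g m e = begin
  (range 2 g ++ range (2 + g + m) e) ++ 1 ∷ range (2 + g) m
    ↭⟨ shift 1 (range 2 g ++ range (2 + g + m) e) (range (2 + g) m) ⟩
  1 ∷ (range 2 g ++ range (2 + g + m) e) ++ range (2 + g) m
    ≡⟨ cong (1 ∷_) (++-assoc (range 2 g) (range (2 + g + m) e) (range (2 + g) m)) ⟩
  1 ∷ range 2 g ++ range (2 + g + m) e ++ range (2 + g) m
    ↭⟨ prep 1 (++⁺ˡ (range 2 g) (++-comm (range (2 + g + m) e) (range (2 + g) m))) ⟩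
  1 ∷ range 2 g ++ range (2 + g) m ++ range (2 + g + m) e
    ≡⟨ cong (λ l → 1 ∷ range 2 g ++ l) (range-++ (2 + g) m e) ⟨
  1 ∷ range 2 g ++ range (2 + g) (m + e)
    ≡⟨ cong (1 ∷_) (range-++ 2 g (m + e)) ⟨
  1 ∷ range 2 (g + (m + e))
    ≡⟨ cong (λ k → 1 ∷ range 2 k) (+-assoc g m e) ⟨
  range 1 (1 + g + m + e) ∎
  where open PermutationReasoning

module Join {g m e : ℕ} (1≤g : 1 ≤ g) (1≤e : 1 ≤ e) {d A r C}
  (mA : IsMatching (outer g m e) (d ∷ A)) (mC : IsMatching (inner g m) (r ∷ C))
  (cA : T (connected (d ∷ A))) (cC : T (connected (r ∷ C)))
  where

  private
    A⁺ = d ∷ A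
    C⁺ = r ∷ C

  left-A : ∀ {x} → x ∈ A⁺ → proj₁ x ∈ outer g m e
  left-A x∈ = ∈-resp-↭ (perm mA) (left∈points x∈)

  right-A : ∀ {x} → x ∈ A⁺ → proj₂ x ∈ outer g m e
  right-A x∈ = ∈-resp-↭ (perm mA) (right∈points x∈)

  r≡1 : proj₁ r ≡ 1
  r≡1 = ≤-antisym (sorted⇒head-minimal (sorted mC) (ascending mC) (∈-resp-↭ (↭-sym (perm mC)) (here refl)))
                  (1≤ (∈-resp-↭ (perm mC) (here refl)))
    where
    1≤ : ∀ {x} → x ∈ inner g m → 1 ≤ x
    1≤ (here refl) = ≤-refl
    1≤ (there x∈) = ≤-trans (s≤s z≤n) (proj₁ (range⁻ (2 + g) m x∈))

  middle : ∀ {x} → x ∈ inner g m → 1 < x → 2 + g ≤ x × x < 2 + g + m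
  middle (here refl) 1<1 = ⊥-elim (<-irrefl refl 1<1)
  middle (there x∈)  _   = range⁻ (2 + g) m x∈

  root-right : 2 + g ≤ proj₂ r × proj₂ r < 2 + g + m
  root-right = middle (∈-resp-↭ (perm mC) (there (here refl)))
    (subst (_< proj₂ r) r≡1 (All.head (ascending mC)))

  tail-left : ∀ {y} → y ∈ C → 2 + g ≤ proj₁ y × proj₁ y < 2 + g + m
  tail-left y∈ = middle (∈-resp-↭ (perm mC) (left∈points (there y∈)))
    (subst (_< _) r≡1 (All.lookup (AllPairs.head (sorted mC)) y∈))

  tail-right : ∀ {y} → y ∈ C → 2 + g ≤ proj₂ y × proj₂ y < 2 + g + m
  tail-right y∈ = middle (∈-resp-↭ (perm mC) (right∈points (there y∈)))
    (≤-<-trans (≤-trans (s≤s z≤n) (proj₁ (tail-left y∈))) (All.lookup (ascending mC) (there y∈)))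

  outside : ∀ {p} → p ∈ outer g m e → ¬ (2 + g ≤ p × p < 2 + g + m)
  outside p∈ (l , u) with outer⁻ g m e p∈
  ... | _ , inj₁ p< , _ = <⇒≱ p< l
  ... | _ , inj₂ ≤p , _ = <⇒≱ u ≤p

  -- Chords of `C` live entirely in the gap, so a crossing would force an end of the chord of `A`
  -- into the gap.
  no-crossing : ∀ {x y} → x ∈ A⁺ → y ∈ C → ¬ Cross x y
  no-crossing x∈ y∈ (inj₁ (_ , y₁<x₂ , x₂<y₂)) = outside (right-A x∈)
    (≤-trans (proj₁ (tail-left y∈)) (<⇒≤ y₁<x₂) , <-trans x₂<y₂ (proj₂ (tail-right y∈)))
  no-crossing x∈ y∈ (inj₂ (y₁<x₁ , x₁<y₂ , _)) = outside (left-A x∈)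
    (≤-trans (proj₁ (tail-left y∈)) (<⇒≤ y₁<x₁) , <-trans x₁<y₂ (proj₂ (tail-right y∈)))

  r<A : All (λ x → proj₁ r < proj₁ x) A⁺
  r<A = All.tabulate λ x∈ → subst (_< _) (sym r≡1) (proj₁ (outer⁻ g m e (left-A x∈)))

  D = join A⁺ C

  join≡ : join A⁺ C⁺ ≡ r ∷ D
  join≡ = join-root A⁺ r C r<A

  D-sorted : Sorted D
  D-sorted = join-sorted A⁺ C (sorted mA) (AllPairs.tail (sorted mC))
    λ x∈ y∈ e → outside (left-A x∈) (subst (λ z → 2 + g ≤ z × z < 2 + g + m) (sym e) (tail-left y∈))

  join-is-sorted : Sorted (r ∷ D)
  join-is-sorted = All.tabulate (λ x∈ →
    [ All.lookup r<A , All.lookup (AllPairs.head (sorted mC)) ]′ (join⁻ A⁺ C x∈)) ∷ D-sorted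

  join-matching : IsMatching (range 1 (1 + g + m + e)) (join A⁺ C⁺)
  join-matching = isMatching (subst Sorted (sym join≡) join-is-sorted)
    (All-resp-↭ (↭-sym (join-↭ A⁺ C⁺)) (All.++⁺ (ascending mA) (ascending mC)))
    (begin
      points (join A⁺ C⁺) ↭⟨ points-↭ (join-↭ A⁺ C⁺) ⟩
      points (A⁺ ++ C⁺) ≡⟨ points-++ A⁺ C⁺ ⟩
      points A⁺ ++ points C⁺ ↭⟨ ++⁺ (perm mA) (perm mC) ⟩
      outer g m e ++ inner g m ↭⟨ outer++inner g m e ⟩
      range 1 (1 + g + m + e) ∎)
    where open PermutationReasoning

  Straddles : Chord → Set
  Straddles x = proj₁ x < 2 + g × 2 + g ≤ proj₂ x

  d≤2 : proj₁ d ≤ 2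
  d≤2 = sorted⇒head-minimal (sorted mA) (ascending mA)
      (∈-resp-↭ (↭-sym (perm mA)) (∈-++⁺ˡ (range⁺ 2 g ≤-refl (s≤s (s≤s 1≤g)))))

  -- Otherwise ending before the gap would pass along crossings from `d`, which starts before it
  -- because `g` is positive, to all of `A`. But the first point after the gap belongs to `A`
  -- because `e` is positive.
  straddling : ∃[ x ] x ∈ A⁺ × Straddles x
  straddling with any? (λ x → (proj₁ x <? 2 + g) ×-dec (2 + g ≤? proj₂ x)) A⁺
  ... | yes some = find some
  ... | no none = ⊥-elim absurd
    where
    low : ∀ {x} → x ∈ A⁺ → proj₁ x < 2 + g → proj₂ x < 2 + g
    low x∈ l = ≰⇒> λ h → none (lose x∈ (l , h))
    all-low : ∀ {x} → x ∈ A⁺ → proj₂ x < 2 + g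
    all-low = connected⁻ d A cA (λ x → proj₂ x < 2 + g)
      (low (here refl) (≤-trans (s≤s d≤2) (s≤s (s≤s 1≤g))))
      λ { _ _ e< (inj₁ (_ , _ , x₂<e₂)) → <-trans x₂<e₂ e<
        ; x∈ _ e< (inj₂ (_ , x₁<e₂ , _)) → low x∈ (<-trans x₁<e₂ e<) }
    last∈ : 2 + g + m ∈ points A⁺
    last∈ = ∈-resp-↭ (↭-sym (perm mA))
      (∈-++⁺ʳ (range 2 g) (range⁺ (2 + g + m) e ≤-refl (m<m+n (2 + g + m) 1≤e)))
    absurd : ⊥
    absurd with a , b , x∈ , w ← points⁻ A⁺ last∈ = <⇒≱ (case w) (m≤m+n (2 + g) m)
      where
      case : 2 + g + m ≡ a ⊎ 2 + g + m ≡ b → 2 + g + m < 2 + g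
      case (inj₁ refl) = <-trans (All.lookup (ascending mA) x∈) (all-low x∈)
      case (inj₂ refl) = all-low x∈

  -- The root reaches `C` inside the second piece. It reaches `A` through a straddling chord, which
  -- it crosses since it runs from 1 into the gap.
  join-Connected : Connected r D
  join-Connected P Pr cl {z} z∈ = [ (λ { refl → Pr }) , [ on-A , on-C ∘ there ]′ ∘ join⁻ A⁺ C ]′ (split z∈)
    where
    split : ∀ {z} → z ∈ r ∷ D → z ≡ r ⊎ z ∈ D
    split (here e)  = inj₁ e
    split (there i) = inj₂ i
    from-A : ∀ {x} → x ∈ A⁺ → x ∈ r ∷ D
    from-A = there ∘ join⁺ˡ A⁺ C
    from-C : ∀ {x} → x ∈ C⁺ → x ∈ r ∷ D
    from-C (here e)   = here e
    from-C (there x∈) = there (join⁺ʳ A⁺ C x∈)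
    on-C : ∀ {x} → x ∈ C⁺ → P x
    on-C = connected⁻ r C cC P Pr (λ d∈ e∈ → cl (from-C d∈) (from-C e∈))
    s = proj₁ straddling
    s∈ = proj₁ (proj₂ straddling)
    s-straddles = proj₂ (proj₂ straddling)
    s₂≥ : 2 + g + m ≤ proj₂ s
    s₂≥ with outer⁻ g m e (right-A s∈)
    ... | _ , inj₁ lt , _ = ⊥-elim (<⇒≱ lt (proj₂ s-straddles))
    ... | _ , inj₂ ge , _ = ge
    Ps : P s
    Ps = cl (from-A s∈) (here refl) Pr (inj₂
      ( All.lookup r<A s∈
      , <-≤-trans (proj₁ s-straddles) (proj₁ root-right)
      , <-≤-trans (proj₂ root-right) s₂≥ ))
    -- The induction principle of d ∷ A starts at d, so P is first carried from s back to d.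
    Pd : P d
    Pd = connected⁻ d A cA (λ x → P x → P d) id
      (λ x∈ y∈ f c Px → f (cl (from-A y∈) (from-A x∈) Px (Sum.swap c))) s∈ Ps
    on-A : ∀ {x} → x ∈ A⁺ → P x
    on-A = connected⁻ d A cA P Pd (λ d∈ e∈ → cl (from-A d∈) (from-A e∈))

  join-connected : T (connected (join A⁺ C⁺))
  join-connected = subst (T ∘ connected) (sym join≡) (connected⁺ r D join-Connected)

  -- The component is taken at the chord following the root. That chord is `d`: it starts at 2 at
  -- the latest, and no chord of `D` starts earlier.
  D-head : ∃[ Z ] D ≡ d ∷ Z
  D-head = go D refl
    where
    go : ∀ E → D ≡ E → ∃[ Z ] D ≡ d ∷ Z
    go [] eq with () ← subst (d ∈_) eq (join⁺ˡ A⁺ C (here refl))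
    go (z ∷ Z) eq with subst (d ∈_) eq (join⁺ˡ A⁺ C (here refl))
    ... | here refl = Z , eq
    ... | there d∈ = ⊥-elim (<⇒≱ (All.lookup (AllPairs.head (subst Sorted eq D-sorted)) d∈)
      (≤-trans d≤2 (2≤ (join⁻ A⁺ C (subst (z ∈_) (sym eq) (here refl))))))
      where
      2≤ : z ∈ A⁺ ⊎ z ∈ C → 2 ≤ proj₁ z
      2≤ (inj₁ z∈) = proj₁ (outer⁻ g m e (left-A z∈))
      2≤ (inj₂ z∈) = ≤-trans (s≤s (s≤s z≤n)) (proj₁ (tail-left z∈))

  -- Without the root, crossings from `A` cannot lead into `C`, and they reach all of `A` because it
  -- is connected.
  component-join : ∀ {Z} → D ≡ d ∷ Z → component (d ∷ Z) d ≡ A⁺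
  component-join {Z} eq = sorted-ext (component-sorted d Z (subst Sorted eq D-sorted)) (sorted mA)
    (λ x∈ → proj₂ (component-induction (_∈ A⁺) (d ∷ Z) d (here refl) (here refl)
       (λ x∈ _ y∈ c → [ id , (λ x∈C → ⊥-elim (no-crossing y∈ x∈C (Sum.swap c))) ]′
         (join⁻ A⁺ C (subst (_ ∈_) (sym eq) x∈))) x∈))
    (connected⁻ d A cA (_∈ component (d ∷ Z) d) (root∈component d Z)
       (λ x∈ _ y∈ c → component-closed d Z (subst (_ ∈_) eq (join⁺ˡ A⁺ C x∈)) y∈ c))

  firstTerminal-join : firstTerminal (join A⁺ C⁺) ≡ suc (firstTerminal A⁺)
  firstTerminal-join with Z , eq ← D-head = begin
    firstTerminal (join A⁺ C⁺) ≡⟨ cong firstTerminal (trans join≡ (cong (r ∷_) eq)) ⟩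
    firstTerminal (r ∷ d ∷ Z) ≡⟨ firstTerminal-step r d Z (subst (λ E → Sorted (r ∷ E)) eq join-is-sorted)
      (subst (λ E → T (connected (r ∷ E))) eq (connected⁺ r D join-Connected)) ⟩
    suc (firstTerminal (component (d ∷ Z) d)) ≡⟨ cong (suc ∘ firstTerminal) (component-join eq) ⟩
    suc (firstTerminal A⁺) ∎
    where open ≡-Reasoning

  A∩C : ∀ {x} → x ∈ A⁺ → x ∉ C⁺
  A∩C x∈ (here refl) = <-irrefl refl (All.lookup r<A x∈)
  A∩C x∈ (there x∈′) = outside (left-A x∈) (tail-left x∈′)

-- Splitting a connected diagram

least : ∀ {Q : ℕ → Set} → (∀ x → Dec (Q x)) → ∀ k a → Q (k + a) →
  ∃[ y ] a ≤ y × y ≤ k + a × Q y × (∀ {z} → a ≤ z → z < y → ¬ Q z)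
least Q? zero    a q = a , ≤-refl , ≤-refl , q , λ a≤z z<a → ⊥-elim (<⇒≱ z<a a≤z)
least {Q} Q? (suc k) a q with Q? a
... | yes Qa = a , ≤-refl , m≤n+m a (suc k) , Qa , λ a≤z z<a → ⊥-elim (<⇒≱ z<a a≤z)
... | no ¬Qa with y , a<y , y≤ , Qy , none ← least Q? k (suc a) (subst Q (sym (+-suc k a)) q) =
  y , <⇒≤ a<y , ≤-trans y≤ (≤-reflexive (+-suc k a)) , Qy , λ {z} a≤z z<y →
    [ (λ a<z → none a<z z<y) , (λ { refl → ¬Qa }) ]′ (m≤n⇒m<n∨m≡n a≤z)

record Decomposition (N : ℕ) (D : Diagram) : Set where
  field
    {g m e} : ℕ
    {d r}   : Chord
    {A C}   : Diagram
    1≤g     : 1 ≤ g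
    1≤e     : 1 ≤ e
    size    : 1 + g + m + e ≡ N
    mA      : IsMatching (outer g m e) (d ∷ A)
    mC      : IsMatching (inner g m) (r ∷ C)
    cA      : T (connected (d ∷ A))
    cC      : T (connected (r ∷ C))
    join≡   : join (d ∷ A) (r ∷ C) ≡ D

module Split {N r d Z} (mD : IsMatching (range 1 N) (r ∷ d ∷ Z)) (cD : T (connected (r ∷ d ∷ Z))) where

  private
    D′ = d ∷ Z
    b = proj₂ r

  -- `C` lacks the root here; the second piece of the decomposition is `r ∷ C`.
  A C : Diagram
  A = component D′ d
  C = filterᵇ (λ x → not (member x A)) D′

  private
    s′ : Sorted D′
    s′ = AllPairs.tail (sorted mD)

    r< : ∀ {x} → x ∈ D′ → proj₁ r < proj₁ x
    r< = All.lookup (AllPairs.head (sorted mD))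

  A⊆ : ∀ {x} → x ∈ A → x ∈ D′
  A⊆ = component⊆ D′ d (here refl)

  C⁻ : ∀ {x} → x ∈ C → x ∈ D′ × x ∉ A
  C⁻ {x} x∈ with x∈D , t ← ∈-filter⁻ (T? ∘ λ x → not (member x A)) {xs = D′} x∈ =
    x∈D , λ x∈A → subst T (to T-not-≡ t) (member⁺ x∈A)

  A⊎C : ∀ {x} → x ∈ D′ → x ∈ A ⊎ x ∈ C
  A⊎C {x} x∈ with member x A in eq
  ... | true  = inj₁ (member⁻ A (from T-≡ eq))
  ... | false = inj₂ (∈-filter⁺ (T? ∘ λ x → not (member x A)) x∈ (from T-not-≡ eq))

  A-sorted : Sorted A
  A-sorted = component-sorted d Z s′

  C-sorted : Sorted C
  C-sorted = AllPairs.filter⁺ (T? ∘ λ x → not (member x A)) s′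

  join≡D′ : join A C ≡ D′
  join≡D′ = sorted-ext (join-sorted A C A-sorted C-sorted lefts-differ) s′
    ([ A⊆ , proj₁ ∘ C⁻ ]′ ∘ join⁻ A C)
    ([ join⁺ˡ A C , join⁺ʳ A C ]′ ∘ A⊎C)
    where
    lefts-differ : ∀ {x y} → x ∈ A → y ∈ C → proj₁ x ≢ proj₁ y
    lefts-differ x∈ y∈ eq with ∈-AllPairs₂ s′ (A⊆ x∈) (proj₁ (C⁻ y∈))
    ... | inj₁ refl     = proj₂ (C⁻ y∈) x∈
    ... | inj₂ (inj₁ l) = <-irrefl eq l
    ... | inj₂ (inj₂ l) = <-irrefl (sym eq) l

  join≡ : join A (r ∷ C) ≡ r ∷ D′
  join≡ = trans (join-root A r C (All.tabulate (r< ∘ A⊆))) (cong (r ∷_) join≡D′)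

  D↭A++C : D′ ↭ A ++ C
  D↭A++C = subst (_↭ A ++ C) join≡D′ (join-↭ A C)

  points-split : points (r ∷ D′) ↭ proj₁ r ∷ b ∷ points A ++ points C
  points-split = prep _ (prep _ (subst (points D′ ↭_) (points-++ A C) (points-↭ D↭A++C)))

  private
    unique : Unique (proj₁ r ∷ b ∷ points A ++ points C)
    unique = Unique-resp-↭ (↭-trans (↭-sym (perm mD)) points-split) (AllPairs.map <⇒≢ (range-increasing 1 N))

    unique-A++C : Unique (points A ++ points C)
    unique-A++C = AllPairs.tail (AllPairs.tail unique)

  disjoint : Disjoint (points A) (points C)
  disjoint = proj₂ (proj₂ (Unique-++⁻ (points A) unique-A++C))

  r∉ : ∀ {p} → p ∈ points A ++ points C → p ≢ proj₁ r
  r∉ p∈ refl = All.lookup (All.tail (AllPairs.head unique)) p∈ refl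

  b∉ : ∀ {p} → p ∈ points A ++ points C → p ≢ b
  b∉ p∈ refl = All.lookup (AllPairs.head (AllPairs.tail unique)) p∈ refl

  b∉A : b ∉ points A
  b∉A b∈ = b∉ (∈-++⁺ˡ b∈) refl

  in-range : ∀ {p} → p ∈ points (r ∷ D′) → 1 ≤ p × p ≤ N
  in-range p∈ with l , u ← range⁻ 1 N (∈-resp-↭ (perm mD) p∈) = l , ≤-pred u

  classify : ∀ {p} → 1 ≤ p → p ≤ N → p ≡ proj₁ r ⊎ p ≡ b ⊎ p ∈ points A ⊎ p ∈ points C
  classify l u with ∈-resp-↭ (↭-trans (↭-sym (perm mD)) points-split) (range⁺ 1 N l (s≤s u))
  ... | here e           = inj₁ e
  ... | there (here e)   = inj₂ (inj₁ e)
  ... | there (there p∈) = inj₂ (inj₂ (∈-++⁻ (points A) p∈))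

  r≡1 : proj₁ r ≡ 1
  r≡1 = ≤-antisym (sorted⇒head-minimal (sorted mD) (ascending mD)
      (∈-resp-↭ (↭-sym (perm mD)) (range⁺ 1 N ≤-refl (s≤s (≤-trans (proj₁ b-range) (proj₂ b-range))))))
    (proj₁ (in-range (here refl)))
    where b-range = in-range (there (here refl))

  root∈A : d ∈ A
  root∈A = root∈component d Z

  A-no-crossing-C : ∀ {x y} → x ∈ A → y ∈ C → ¬ Cross y x
  A-no-crossing-C x∈ y∈ c = proj₂ (C⁻ y∈) (component-closed d Z (proj₁ (C⁻ y∈)) x∈ c)

  -- Otherwise lying outside `A` would pass along crossings from the root to every chord, `d`
  -- included. The edge leaves `r` because `r` has the smallest left end.
  crosses-root : ∃[ x ] x ∈ A × Edge r x
  crosses-root with any? (λ x → T? (edge r x)) A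
  ... | yes some with x , x∈ , t ← find some = x , x∈ , edge⁻ r x t
  ... | no none = ⊥-elim (connected⁻ r D′ cD (_∉ A) (λ r∈ → <-irrefl refl (r< (A⊆ r∈)))
      spread (there (here refl)) root∈A)
    where
    spread : ∀ {x y} → x ∈ r ∷ D′ → y ∈ r ∷ D′ → y ∉ A → Cross x y → x ∉ A
    spread {x} _ (here refl) _ (inj₁ (l , _)) x∈A = <-asym l (r< (A⊆ x∈A))
    spread {x} _ (here refl) _ (inj₂ c) x∈A = none (lose x∈A (edge⁺ r x c))
    spread _ (there y∈) y∉ c x∈A = y∉ (component-closed d Z y∈ x∈A (Sum.swap c))

  points-A≥ : ∀ {p} → p ∈ points A ++ points C → 2 ≤ p
  points-A≥ {p} p∈ = ≤∧≢⇒< (proj₁ (in-range (∈-resp-↭ (↭-sym points-split) (there (there p∈)))))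
    (λ e → r∉ p∈ (trans (sym e) (sym r≡1)))

  private
    D≥ : ∀ {p} → p ∈ points D′ → proj₁ d ≤ p
    D≥ = sorted⇒head-minimal s′ (All.tail (ascending mD))

  d<b : proj₁ d < b
  d<b with x , x∈ , _ , x₁<b , _ ← crosses-root =
    ≤-<-trans (D≥ (left∈points (A⊆ x∈))) x₁<b

  -- The point 2 is either an end of a chord of `D′`, all of which are at least the left end of `d`,
  -- or it is `b`, which lies beyond that left end.
  d≡2 : proj₁ d ≡ 2
  d≡2 = ≤-antisym d≤2 (points-A≥ (∈-++⁺ˡ (left∈points root∈A)))
    where
    AC⇒D : ∀ {p} → p ∈ points A ++ points C → p ∈ points D′
    AC⇒D {p} p∈ = ∈-resp-↭ (points-↭ (↭-sym D↭A++C)) (subst (p ∈_) (sym (points-++ A C)) p∈)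
    1<b : 1 < b
    1<b = subst (_< b) r≡1 (All.head (ascending mD))
    d≤2 : proj₁ d ≤ 2
    d≤2 with classify (s≤s z≤n) (≤-trans 1<b (proj₂ (in-range (there (here refl)))))
    ... | inj₁ e               = ⊥-elim (<⇒≢ ≤-refl (sym (trans e r≡1)))
    ... | inj₂ (inj₁ refl)     = <⇒≤ d<b
    ... | inj₂ (inj₂ (inj₁ p)) = D≥ (AC⇒D (∈-++⁺ˡ p))
    ... | inj₂ (inj₂ (inj₂ p)) = D≥ (AC⇒D (∈-++⁺ʳ (points A) p))

  A-root-connected : ∀ (P : Chord → Set) → P d →
    (∀ {x y} → x ∈ A → y ∈ A → P y → Cross x y → P x) → ∀ {x} → x ∈ A → P x
  A-root-connected P Pd cl x∈ = proj₂ (proj₂ (component-induction (λ x → x ∈ A × P x) D′ d (here refl)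
    (root∈A , Pd) (λ x∈ _ (y∈A , Py) c → let x∈A = component-closed d Z x∈ y∈A c in
      x∈A , cl x∈A y∈A Py c) x∈))

  A-ascending : ∀ {x} → x ∈ A → proj₁ x < proj₂ x
  A-ascending x∈ = All.lookup (ascending mD) (there (A⊆ x∈))

  C-ascending : ∀ {y} → y ∈ C → proj₁ y < proj₂ y
  C-ascending y∈ = All.lookup (ascending mD) (there (proj₁ (C⁻ y∈)))

  -- A chord that crosses no chord of the connected A has all of A on one side.
  Avoids : Chord → Chord → Set
  Avoids (y₁ , y₂) (x₁ , x₂) = ¬ (y₁ < x₁ × x₁ < y₂) × ¬ (y₁ < x₂ × x₂ < y₂)

  -- `d` starts before `y`, so it has no end under `y` without crossing it. If `z` has no end under
  -- `y` and `x` crosses `z`, then `x` is not wholly under `y`, since an end of `z` lies under `x`;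
  -- and exactly one end of `x` under `y` would be a crossing with `y`.
  A-avoids-C : ∀ {x y} → x ∈ A → y ∈ C → Avoids y x
  A-avoids-C {y = y@(y₁ , y₂)} x∈A y∈ = A-root-connected (Avoids y) avoids-d spread x∈A
    where
    d<y : proj₁ d < y₁
    d<y = ≤∧≢⇒< (D≥ (left∈points (proj₁ (C⁻ y∈)))) (λ { refl → disjoint (left∈points root∈A , left∈points y∈) })
    avoids-d : Avoids y d
    avoids-d = (λ (l , _) → <-asym l d<y)
          , (λ (l , u) → A-no-crossing-C root∈A y∈ (inj₂ (d<y , l , u)))
    spread : ∀ {x z} → x ∈ A → z ∈ A → Avoids y z → Cross x z → Avoids y x
    spread {x₁ , x₂} {z₁ , z₂} x∈ z∈ (o₁ , o₂) c = left , right
      where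
      inside : Cross (x₁ , x₂) (z₁ , z₂) → y₁ < x₁ → x₂ < y₂ → ⊥
      inside (inj₁ (x₁<z₁ , z₁<x₂ , _)) l u = o₁ (<-trans l x₁<z₁ , <-trans z₁<x₂ u)
      inside (inj₂ (_ , x₁<z₂ , z₂<x₂)) l u = o₂ (<-trans l x₁<z₂ , <-trans z₂<x₂ u)
      left : ¬ (y₁ < x₁ × x₁ < y₂)
      left (l , u) with <-cmp x₂ y₂
      ... | tri< x₂<y₂ _ _ = inside c l x₂<y₂
      ... | tri≈ _ refl _  = disjoint (right∈points x∈ , right∈points y∈)
      ... | tri> _ _ y₂<x₂ = A-no-crossing-C x∈ y∈ (inj₁ (l , u , y₂<x₂))
      right : ¬ (y₁ < x₂ × x₂ < y₂)
      right (l , u) with <-cmp x₁ y₁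
      ... | tri< x₁<y₁ _ _ = A-no-crossing-C x∈ y∈ (inj₂ (x₁<y₁ , l , u))
      ... | tri≈ _ refl _  = disjoint (left∈points x∈ , left∈points y∈)
      ... | tri> _ _ y₁<x₁ = inside c y₁<x₁ u

  not-under-C : ∀ {y} → y ∈ C → ∀ {q} → q ∈ points A → proj₁ y < q → ¬ q < proj₂ y
  not-under-C {y₁ , y₂} y∈ {q} q∈ y₁<q q<y₂ with points⁻ A q∈
  ... | _ , _ , x∈ , inj₁ refl = proj₁ (A-avoids-C x∈ y∈) (y₁<q , q<y₂)
  ... | _ , _ , x∈ , inj₂ refl = proj₂ (A-avoids-C x∈ y∈) (y₁<q , q<y₂)

  -- The chords lying in a gap of A other than the one of b would form a union of components of the
  -- whole diagram not containing the root.
  same-gap-as-b : ∀ {p q} → p ∈ points C → q ∈ points A → ¬ ((p < q × q < b) ⊎ (b < q × q < p))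
  same-gap-as-b {p} {q₀} p∈ q₀∈ separated with y₁ , y₂ , y∈ , w ← points⁻ C p∈ =
    connected⁻ r D′ cD (λ x → ¬ Gap (proj₁ x)) ¬gap-root spread (there (proj₁ (C⁻ y∈))) (gap-y w)
    where
    -- The gap of `A` containing `p`, described without its boundary points: every point of `A` lies
    -- on the same side of `y` as of `p`.
    Gap : ℕ → Set
    Gap y = y ∉ points A × (∀ {q} → q ∈ points A → (q < p → q < y) × (p < q → y < q))
    gap-p : Gap p
    gap-p = (λ p∈A → disjoint (p∈A , p∈)) , λ _ → id , id
    -- No point of `A` lies under a chord of `C`, so both ends of the chord are in one gap.
    gap→ : ∀ {y} → y ∈ C → Gap (proj₁ y) → Gap (proj₂ y)
    gap→ {y₁ , y₂} y∈ (_ , f) = (λ y₂∈ → disjoint (y₂∈ , right∈points y∈)) , λ {q} q∈ →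
      (λ q<p → <-trans (proj₁ (f q∈) q<p) (C-ascending y∈)) ,
      (λ p<q → ≤∧≢⇒< (≮⇒≥ (not-under-C y∈ q∈ (proj₂ (f q∈) p<q)))
                     (λ { refl → disjoint (q∈ , right∈points y∈) }))
    gap← : ∀ {y} → y ∈ C → Gap (proj₂ y) → Gap (proj₁ y)
    gap← {y₁ , y₂} y∈ (_ , f) = (λ y₁∈ → disjoint (y₁∈ , left∈points y∈)) , λ {q} q∈ →
      (λ q<p → ≤∧≢⇒< (≮⇒≥ (λ y₁<q → not-under-C y∈ q∈ y₁<q (proj₁ (f q∈) q<p)))
                     (λ { refl → disjoint (q∈ , left∈points y∈) })) ,
      (λ p<q → <-trans (C-ascending y∈) (proj₂ (f q∈) p<q))
    gap-between : ∀ {y z} → Gap (proj₁ y) → Gap (proj₂ y) → proj₁ y < z → z < proj₂ y → z ∉ points A → Gap z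
    gap-between (_ , f) (_ , h) l u z∉ = z∉ , λ q∈ →
      (λ q<p → <-trans (proj₁ (f q∈) q<p) l) , (λ p<q → <-trans u (proj₂ (h q∈) p<q))
    ¬gap-root : ¬ Gap (proj₁ r)
    ¬gap-root (_ , f) = <-asym (r< (here refl)) (proj₁ (f (left∈points root∈A))
      (≤∧≢⇒< (D≥ (∈-resp-↭ (points-↭ (↭-sym D↭A++C)) (subst (p ∈_) (sym (points-++ A C)) (∈-++⁺ʳ (points A) p∈))))
        (λ { refl → disjoint (left∈points root∈A , p∈) })))
    ¬gap-b : ¬ Gap b
    ¬gap-b (_ , f) = [ (λ (p<q , q<b) → <-asym q<b (proj₂ (f q₀∈) p<q))
                     , (λ (b<q , q<p) → <-asym b<q (proj₁ (f q₀∈) q<p)) ]′ separated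
    C-case : ∀ {x y} → x ∈ C → y ∈ r ∷ D′ → ¬ Gap (proj₁ y) → Cross x y → ¬ Gap (proj₁ x)
    C-case x∈ (here refl) _ (inj₁ (l , _)) _ = <-asym l (r< (proj₁ (C⁻ x∈)))
    C-case x∈ (here refl) _ (inj₂ (_ , l , u)) gx = ¬gap-b (gap-between gx (gap→ x∈ gx) l u b∉A)
    C-case x∈ (there y∈) ¬gy c gx with A⊎C y∈
    ... | inj₁ y∈A = A-no-crossing-C y∈A x∈ c
    ... | inj₂ y∈C with c
    ...   | inj₁ (l , u , _) = ¬gy (gap-between gx (gap→ x∈ gx) l u (λ y₁∈ → disjoint (y₁∈ , left∈points y∈C)))
    ...   | inj₂ (_ , l , u) = ¬gy (gap← y∈C (gap-between gx (gap→ x∈ gx) l u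
                                  (λ y₂∈ → disjoint (y₂∈ , right∈points y∈C))))
    spread : ∀ {x y} → x ∈ r ∷ D′ → y ∈ r ∷ D′ → ¬ Gap (proj₁ y) → Cross x y → ¬ Gap (proj₁ x)
    spread (here refl) _ _ _ = ¬gap-root
    spread (there x∈) y∈ ¬gy c with A⊎C x∈
    ... | inj₁ x∈A = λ gx → proj₁ gx (left∈points x∈A)
    ... | inj₂ x∈C = C-case x∈C y∈ ¬gy c
    gap-y : p ≡ y₁ ⊎ p ≡ y₂ → Gap y₁
    gap-y (inj₁ refl) = gap-p
    gap-y (inj₂ refl) = gap← y∈ gap-p

  -- A path from the root that enters `A` can leave it only through the root, because `A` is closed
  -- under crossing in `D′`. Hence the alternative `y ∈ A` in the property that is propagated.
  C-connected : T (connected (r ∷ C))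
  C-connected = connected⁺ r C λ P Pr cl {x} x∈ → [ (λ x∈A → ⊥-elim (not-in-A x∈ x∈A)) , proj₂ ]′
    (connected⁻ r D′ cD (λ y → y ∈ A ⊎ (y ∈ r ∷ C × P y)) (inj₂ (here refl , Pr))
      (λ { (here refl) _ _ _ → inj₂ (here refl , Pr)
         ; (there x∈D) _ (inj₁ y∈A) c → inj₁ (component-closed d Z x∈D y∈A c)
         ; (there x∈D) _ (inj₂ (y∈C , Py)) c →
             Sum.map₂ (λ x∈C → there x∈C , cl (there x∈C) y∈C Py c) (A⊎C x∈D) })
      (include x∈))
    where
    include : ∀ {x} → x ∈ r ∷ C → x ∈ r ∷ D′
    include (here e)   = here e
    include (there x∈) = there (proj₁ (C⁻ x∈))
    not-in-A : ∀ {x} → x ∈ r ∷ C → x ∉ A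
    not-in-A (here refl) x∈A = <-irrefl refl (r< (A⊆ x∈A))
    not-in-A (there x∈)      = proj₂ (C⁻ x∈)

  private
    2≤b : 2 ≤ b
    2≤b = subst (_< b) r≡1 (All.head (ascending mD))

    A≤N : ∀ {p} → p ∈ points A ++ points C → p ≤ N
    A≤N p∈ = proj₂ (in-range (∈-resp-↭ (↭-sym points-split) (there (there p∈))))

  -- `v` is the first point after 1 outside `A`, and `u` the first point of `A` after `v`. That the
  -- points from `v` up to `u` form the only gap follows from `same-gap-as-b`.
  module Interval {v u} (2≤v : 2 ≤ v) (v≤b : v ≤ b) (v∉A : v ∉ points A)
    (before-v : ∀ {p} → 2 ≤ p → p < v → p ∈ points A)
    (v≤u : v ≤ u) (u∈A : u ∈ points A) (in-gap : ∀ {p} → v ≤ p → p < u → p ∉ points A)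
    where

    private
      2<v : 2 < v
      2<v = ≤∧≢⇒< 2≤v λ 2≡v → v∉A (subst (_∈ points A) (trans d≡2 2≡v) (left∈points root∈A))

      u≤N : u ≤ N
      u≤N = A≤N (∈-++⁺ˡ u∈A)

      non-A : ∀ {p} → 2 ≤ p → p ≤ N → p ≢ b → p ∉ points A → p ∈ points C
      non-A l h p≢b p∉A with classify (<⇒≤ l) h
      ... | inj₁ e                = ⊥-elim (<-irrefl (sym (trans e r≡1)) l)
      ... | inj₂ (inj₁ e)         = ⊥-elim (p≢b e)
      ... | inj₂ (inj₂ (inj₁ p∈)) = ⊥-elim (p∉A p∈)
      ... | inj₂ (inj₂ (inj₂ p∈)) = p∈

      -- If `u` came before `b`, then `v` would be a point of `C` separated from `b` by `u`.
      b<u : b < u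
      b<u = ≰⇒> λ u≤b →
        let u<b = ≤∧≢⇒< u≤b (λ u≡b → b∉A (subst (_∈ points A) u≡b u∈A))
            v<u = ≤∧≢⇒< v≤u (λ v≡u → v∉A (subst (_∈ points A) (sym v≡u) u∈A))
        in same-gap-as-b
             (non-A 2≤v (≤-trans v≤u u≤N) (<⇒≢ (<-trans v<u u<b)) v∉A)
             u∈A (inj₁ (v<u , u<b))

      -- A point beyond `u` outside `A` would belong to `C` and be separated from `b` by `u`.
      after-u : ∀ {p} → u ≤ p → p ≤ N → p ∈ points A
      after-u {p} l h with p ∈? points A
      ... | yes p∈ = p∈
      ... | no p∉ = ⊥-elim (same-gap-as-b
        (non-A (≤-trans 2≤v (≤-trans v≤u l)) h (<⇒≢ (<-≤-trans b<u l) ∘ sym) p∉) u∈A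
        (inj₂ (b<u , ≤∧≢⇒< l (λ { refl → p∉ u∈A }))))

      -- The numbers of points from 2 up to `v`, from `v` up to `u` (upper ends excluded), and from
      -- `u` to `N` inclusive.
      g m e : ℕ
      g = v ∸ 2
      m = u ∸ v
      e = suc N ∸ u

      v≡ : 2 + g ≡ v
      v≡ = m+[n∸m]≡n 2≤v

      u≡ : 2 + g + m ≡ u
      u≡ = trans (cong (_+ m) v≡) (m+[n∸m]≡n v≤u)

      N≡ : 2 + g + m + e ≡ suc N
      N≡ = trans (cong (_+ e) u≡) (m+[n∸m]≡n (m≤n⇒m≤1+n u≤N))

      A⇒outer : ∀ {p} → p ∈ points A → p ∈ outer g m e
      A⇒outer {p} p∈ with p <? v | p <? u
      ... | yes p<v | _ = ∈-++⁺ˡ (range⁺ 2 g (points-A≥ (∈-++⁺ˡ p∈)) (subst (p <_) (sym v≡) p<v))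
      ... | no p≮v | yes p<u = ⊥-elim (in-gap (≮⇒≥ p≮v) p<u p∈)
      ... | no _   | no p≮u  = ∈-++⁺ʳ (range 2 g) (range⁺ (2 + g + m) e
        (subst (_≤ p) (sym u≡) (≮⇒≥ p≮u)) (subst (p <_) (sym N≡) (s≤s (A≤N (∈-++⁺ˡ p∈)))))

      outer⇒A : ∀ {p} → p ∈ outer g m e → p ∈ points A
      outer⇒A {p} p∈ with outer⁻ g m e p∈
      ... | 2≤p , inj₁ p< , _ = before-v 2≤p (subst (p <_) v≡ p<)
      ... | _ , inj₂ ≤p , p< = after-u (subst (_≤ p) u≡ ≤p) (≤-pred (subst (p <_) N≡ p<))

      C⇒inner : ∀ {p} → p ∈ points (r ∷ C) → p ∈ inner g m
      C⇒inner (here refl) = here r≡1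
      C⇒inner (there (here refl)) = there (range⁺ (2 + g) m (subst (_≤ b) (sym v≡) v≤b) (subst (b <_) (sym u≡) b<u))
      C⇒inner {p} (there (there p∈)) = there (range⁺ (2 + g) m
        (subst (_≤ p) (sym v≡) (≮⇒≥ λ p<v → disjoint (before-v (points-A≥ p∈′) p<v , p∈)))
        (subst (p <_) (sym u≡) (≰⇒> λ u≤p → disjoint (after-u u≤p (A≤N p∈′) , p∈))))
        where p∈′ = ∈-++⁺ʳ (points A) p∈

      inner⇒C : ∀ {p} → p ∈ inner g m → p ∈ points (r ∷ C)
      inner⇒C (here refl) = here (sym r≡1)
      inner⇒C {p} (there p∈) with l , h ← range⁻ (2 + g) m p∈ | p ≟ b
      ... | yes refl = there (here refl)
      ... | no p≢b = there (there (non-A (≤-trans (s≤s (s≤s z≤n)) l)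
        (≤-trans (<⇒≤ p<u) u≤N) p≢b (in-gap (subst (_≤ p) v≡ l) p<u)))
        where p<u = subst (p <_) u≡ h

      unique-r∷C : Unique (points (r ∷ C))
      unique-r∷C with u₁ , u₂ , _ ← Unique-++⁻ (points A) unique-A++C =
        (All.head (AllPairs.head unique) ∷ All.++⁻ʳ (points A) (All.tail (AllPairs.head unique)))
        ∷ All.++⁻ʳ (points A) (AllPairs.head (AllPairs.tail unique)) ∷ u₂

    A-matching : IsMatching (outer g m e) A
    A-matching = isMatching A-sorted (All.tabulate A-ascending)
      (unique∧sets⇒↭ (proj₁ (Unique-++⁻ (points A) unique-A++C))
        (AllPairs.map <⇒≢ (outer-increasing g m e)) A⇒outer outer⇒A)

    C-matching : IsMatching (inner g m) (r ∷ C)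
    C-matching = isMatching (All.tabulate (λ y∈ → r< (proj₁ (C⁻ y∈))) ∷ C-sorted)
      (All.head (ascending mD) ∷ All.tabulate C-ascending)
      (unique∧sets⇒↭ unique-r∷C (AllPairs.map <⇒≢ (inner-increasing g m)) C⇒inner inner⇒C)

    interval-decomposition : Decomposition N (r ∷ D′)
    interval-decomposition with p , eq ← component-cons d Z = record
      { 1≤g   = ≤-pred (≤-pred (subst (3 ≤_) (sym v≡) 2<v))
      ; 1≤e   = m<n⇒0<n∸m (s≤s u≤N)
      ; size  = suc-injective N≡
      ; mA    = subst (IsMatching (outer g m e)) eq A-matching
      ; mC    = C-matching
      ; cA    = subst (T ∘ connected) eq (component-connected d Z)
      ; cC    = C-connected
      ; join≡ = subst (λ A → join A (r ∷ C) ≡ r ∷ D′) eq join≡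
      }

  -- Both searches succeed: `b` is not in `A`, so `v` is at most `b`, and a chord of `A` crossing
  -- the root ends after `b`, which bounds `u`.
  decomposition : Decomposition N (r ∷ D′)
  decomposition with x , x∈ , _ , _ , b<x₂ ← crosses-root
    with v , 2≤v , v≤ , v∉A , none ← least (λ p → ¬? (p ∈? points A)) (b ∸ 2) 2
           (subst (_∉ points A) (sym (m∸n+n≡m 2≤b)) b∉A)
    with v≤b ← ≤-trans v≤ (≤-reflexive (m∸n+n≡m 2≤b))
    with u , v≤u , _ , u∈A , in-gap ← least (_∈? points A) (proj₂ x ∸ v) v
           (subst (_∈ points A) (sym (m∸n+n≡m (≤-trans v≤b (<⇒≤ b<x₂)))) (right∈points x∈)) =
    Interval.interval-decomposition 2≤v v≤b v∉A
      (λ {p} l h → decidable-stable (p ∈? points A) (none l h)) v≤u u∈A in-gap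

-- Order-preserving relabelling

connectedMatchings : ℕ → List ℕ → List Diagram
connectedMatchings n xs = filterᵇ connected (matchings n xs)

module _ {A B : Set} (f : A → B) {p : B → Bool} {q : A → Bool} (pf≡q : ∀ x → p (f x) ≡ q x) where

  any-map : ∀ xs → any p (map f xs) ≡ any q xs
  any-map []       = refl
  any-map (x ∷ xs) = cong₂ _∨_ (pf≡q x) (any-map xs)

  filterᵇ-map : ∀ xs → filterᵇ p (map f xs) ≡ map f (filterᵇ q xs)
  filterᵇ-map []       = refl
  filterᵇ-map (x ∷ xs) rewrite pf≡q x with q x
  ... | true  = cong (f x ∷_) (filterᵇ-map xs)
  ... | false = filterᵇ-map xs

firstIndex-map : ∀ f {p q} → (∀ x → p (f x) ≡ q x) → ∀ xs → firstIndex p (map f xs) ≡ firstIndex q xs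
firstIndex-map f h []       = refl
firstIndex-map f {p} {q} h (x ∷ xs) rewrite h x with q x
... | true = refl
... | false rewrite firstIndex-map f {p} {q} h xs = refl

-- Endpoints are compared only by `<ᵇ` and `≡ᵇ`, which a strictly increasing map preserves and
-- reflects, so every construction commutes with it. This reduces counts over the points of a piece
-- to counts over 1, ..., 2k.
module Relabel (h : ℕ → ℕ) (h-mono : ∀ {x y} → x < y → h x < h y) where

  <ᵇ-relabel : ∀ x y → (h x <ᵇ h y) ≡ (x <ᵇ y)
  <ᵇ-relabel x y = T-ext reflects (<⇒<ᵇ ∘ h-mono ∘ <ᵇ⇒< x y)
    where
    reflects : T (h x <ᵇ h y) → T (x <ᵇ y)
    reflects t with <-cmp x y
    ... | tri< x<y _ _ = <⇒<ᵇ x<y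
    ... | tri≈ _ refl _ = ⊥-elim (<-irrefl refl (<ᵇ⇒< (h x) (h y) t))
    ... | tri> _ _ y<x = ⊥-elim (<-asym (h-mono y<x) (<ᵇ⇒< (h x) (h y) t))

  ≡ᵇ-relabel : ∀ x y → (h x ≡ᵇ h y) ≡ (x ≡ᵇ y)
  ≡ᵇ-relabel x y = T-ext reflects (≡⇒≡ᵇ (h x) (h y) ∘ cong h ∘ ≡ᵇ⇒≡ x y)
    where
    reflects : T (h x ≡ᵇ h y) → T (x ≡ᵇ y)
    reflects t with <-cmp x y
    ... | tri< x<y _ _ = ⊥-elim (<-irrefl (≡ᵇ⇒≡ (h x) (h y) t) (h-mono x<y))
    ... | tri≈ _ x≡y _ = ≡⇒≡ᵇ x y x≡y
    ... | tri> _ _ y<x = ⊥-elim (<-irrefl (sym (≡ᵇ⇒≡ (h x) (h y) t)) (h-mono y<x))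

  relabel : Chord → Chord
  relabel (a , b) = h a , h b

  edge-relabel : ∀ x y → edge (relabel x) (relabel y) ≡ edge x y
  edge-relabel (a , b) (c , d) =
    cong₂ _∧_ (<ᵇ-relabel a c) (cong₂ _∧_ (<ᵇ-relabel c b) (<ᵇ-relabel b d))

  crossing-relabel : ∀ x y → crossing (relabel x) (relabel y) ≡ crossing x y
  crossing-relabel x y = cong₂ _∨_ (edge-relabel x y) (edge-relabel y x)

  member-relabel : ∀ S x → member (relabel x) (map relabel S) ≡ member x S
  member-relabel S x@(a , b) = any-map relabel
    (λ (c , d) → cong₂ _∧_ (≡ᵇ-relabel a c) (≡ᵇ-relabel b d)) S

  step-relabel : ∀ D S → step (map relabel D) (map relabel S) ≡ map relabel (step D S)
  step-relabel D S = filterᵇ-map relabel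
    (λ x → cong₂ _∨_ (member-relabel S x) (any-map relabel (crossing-relabel x) S)) D

  iterate-relabel : ∀ k D S → iterate k (map relabel D) (map relabel S) ≡ map relabel (iterate k D S)
  iterate-relabel zero    D S = refl
  iterate-relabel (suc k) D S rewrite step-relabel D S = iterate-relabel k D (step D S)

  component-relabel : ∀ D c → component (map relabel D) (relabel c) ≡ map relabel (component D c)
  component-relabel D c rewrite length-map relabel D = iterate-relabel (length D) D (c ∷ [])

  connected-relabel : ∀ D → connected (map relabel D) ≡ connected D
  connected-relabel [] = refl
  connected-relabel (c ∷ D) = cong₂ _≡ᵇ_
    (trans (cong length (component-relabel (c ∷ D) c)) (length-map relabel (component (c ∷ D) c)))
    (length-map relabel (c ∷ D))

  components-relabel : ∀ k D → components k (map relabel D) ≡ map (map relabel) (components k D)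
  components-relabel zero    D       = refl
  components-relabel (suc k) []      = refl
  components-relabel (suc k) (c ∷ D) = cong₂ _∷_ (component-relabel (c ∷ D) c)
    (trans (cong (components k) (filterᵇ-map relabel
             {p = λ x → not (member x (component (relabel c ∷ map relabel D) (relabel c)))}
             (λ x → cong not (trans (cong (member (relabel x)) (component-relabel (c ∷ D) c))
                                    (member-relabel (component (c ∷ D) c) x))) (c ∷ D)))
           (components-relabel k _))

  intOrder-relabel : ∀ k D → intOrder k (map relabel D) ≡ map relabel (intOrder k D)
  intOrder-relabel zero    D       = refl
  intOrder-relabel (suc k) []      = refl
  intOrder-relabel (suc k) (r ∷ D) = cong (relabel r ∷_) (begin
    concatMap (intOrder k) (components (length (map relabel D)) (map relabel D))
      ≡⟨ cong (λ l → concatMap (intOrder k) (components l (map relabel D))) (length-map relabel D) ⟩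
    concatMap (intOrder k) (components (length D) (map relabel D))
      ≡⟨ cong (concatMap (intOrder k)) (components-relabel (length D) D) ⟩
    concatMap (intOrder k) (map (map relabel) (components (length D) D))
      ≡⟨ concatMap-map (intOrder k) (map relabel) (components (length D) D) ⟩
    concatMap (intOrder k ∘ map relabel) (components (length D) D)
      ≡⟨ concatMap-cong (intOrder-relabel k) (components (length D) D) ⟩
    concatMap (map relabel ∘ intOrder k) (components (length D) D)
      ≡⟨ map-concatMap relabel (intOrder k) (components (length D) D) ⟨
    map relabel (concatMap (intOrder k) (components (length D) D)) ∎)
    where open ≡-Reasoning

  firstTerminal-relabel : ∀ D → firstTerminal (map relabel D) ≡ firstTerminal D
  firstTerminal-relabel D rewrite length-map relabel D | intOrder-relabel (length D) D =
    firstIndex-map relabel (λ x → cong not (any-map relabel (edge-relabel x) D)) (intOrder (length D) D)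

  picks-relabel : ∀ xs → picks (map h xs) ≡ map (λ (y , ys) → h y , map h ys) (picks xs)
  picks-relabel []       = refl
  picks-relabel (x ∷ xs) = cong ((h x , map h xs) ∷_) (begin
    map (λ (y , ys) → y , h x ∷ ys) (picks (map h xs))
      ≡⟨ cong (map _) (picks-relabel xs) ⟩
    map (λ (y , ys) → y , h x ∷ ys) (map (λ (y , ys) → h y , map h ys) (picks xs))
      ≡⟨ map-∘ (picks xs) ⟨
    map (λ (y , ys) → h y , h x ∷ map h ys) (picks xs)
      ≡⟨ map-∘ (picks xs) ⟩
    map (λ (y , ys) → h y , map h ys) (map (λ (y , ys) → y , x ∷ ys) (picks xs)) ∎)
    where open ≡-Reasoning

  matchings-relabel : ∀ n xs → matchings n (map h xs) ≡ map (map relabel) (matchings n xs)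
  matchings-relabel zero    []       = refl
  matchings-relabel zero    (x ∷ xs) = refl
  matchings-relabel (suc n) []       = refl
  matchings-relabel (suc n) (x ∷ xs) = begin
    concatMap f′ (picks (map h xs)) ≡⟨ cong (concatMap f′) (picks-relabel xs) ⟩
    concatMap f′ (map g (picks xs)) ≡⟨ concatMap-map f′ g (picks xs) ⟩
    concatMap (f′ ∘ g) (picks xs) ≡⟨ concatMap-cong f′g (picks xs) ⟩
    concatMap (map (map relabel) ∘ f) (picks xs) ≡⟨ map-concatMap (map relabel) f (picks xs) ⟨
    map (map relabel) (concatMap f (picks xs)) ∎
    where
    open ≡-Reasoning
    f f′ : ℕ × List ℕ → List Diagram
    f p = map ((x , proj₁ p) ∷_) (matchings n (proj₂ p))
    f′ p = map ((h x , proj₁ p) ∷_) (matchings n (proj₂ p))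
    g : ℕ × List ℕ → ℕ × List ℕ
    g (y , ys) = h y , map h ys
    f′g : ∀ p → f′ (g p) ≡ map (map relabel) (f p)
    f′g (y , ys) = begin
      map ((h x , h y) ∷_) (matchings n (map h ys)) ≡⟨ cong (map _) (matchings-relabel n ys) ⟩
      map ((h x , h y) ∷_) (map (map relabel) (matchings n ys)) ≡⟨ map-∘ (matchings n ys) ⟨
      map (λ D → relabel (x , y) ∷ map relabel D) (matchings n ys) ≡⟨ map-∘ (matchings n ys) ⟩
      map (map relabel) (map ((x , y) ∷_) (matchings n ys)) ∎

  connectedMatchings-relabel : ∀ n xs →
    connectedMatchings n (map h xs) ≡ map (map relabel) (connectedMatchings n xs)
  connectedMatchings-relabel n xs rewrite matchings-relabel n xs =
    filterᵇ-map (map relabel) connected-relabel (matchings n xs)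

  length-connectedMatchings-relabel : ∀ n xs →
    length (connectedMatchings n (map h xs)) ≡ length (connectedMatchings n xs)
  length-connectedMatchings-relabel n xs rewrite connectedMatchings-relabel n xs =
    length-map (map relabel) (connectedMatchings n xs)

  sum-firstTerminal-relabel : ∀ n xs →
    sum (map firstTerminal (connectedMatchings n (map h xs))) ≡
    sum (map firstTerminal (connectedMatchings n xs))
  sum-firstTerminal-relabel n xs rewrite connectedMatchings-relabel n xs =
    cong sum (trans (sym (map-∘ (connectedMatchings n xs)))
                    (map-cong firstTerminal-relabel (connectedMatchings n xs)))

-- The recurrences

-- conv f n is the sum of f i j over all i + j ≡ n.
conv : (ℕ → ℕ → ℕ) → ℕ → ℕ
conv f zero    = f 0 0
conv f (suc n) = f 0 (suc n) + conv (λ i j → f (suc i) j) n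

conv-cong : ∀ {f g} n → (∀ i j → i + j ≡ n → f i j ≡ g i j) → conv f n ≡ conv g n
conv-cong zero    e = e 0 0 refl
conv-cong (suc n) e =
  cong₂ _+_ (e 0 (suc n) refl) (conv-cong n λ i j p → e (suc i) j (cong suc p))

conv-mono : ∀ {f g} n → (∀ i j → i + j ≡ n → f i j ≤ g i j) → conv f n ≤ conv g n
conv-mono zero    e = e 0 0 refl
conv-mono (suc n) e =
  +-mono-≤ (e 0 (suc n) refl) (conv-mono n λ i j p → e (suc i) j (cong suc p))

conv-+ : ∀ f g n → conv (λ i j → f i j + g i j) n ≡ conv f n + conv g n
conv-+ f g zero    = refl
conv-+ f g (suc n) =
  trans (cong ((f 0 (suc n) + g 0 (suc n)) +_) (conv-+ (f ∘ suc) (g ∘ suc) n))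
        (interchange (f 0 (suc n)) (g 0 (suc n)) _ _)
  where
  interchange : ∀ a b c d → (a + b) + (c + d) ≡ (a + c) + (b + d)
  interchange = solve-∀

conv-* : ∀ a f n → conv (λ i j → a * f i j) n ≡ a * conv f n
conv-* a f zero    = refl
conv-* a f (suc n) =
  trans (cong (a * f 0 (suc n) +_) (conv-* a (f ∘ suc) n)) (sym (*-distribˡ-+ a _ _))

conv-snoc : ∀ f n → conv f (suc n) ≡ conv (λ i j → f i (suc j)) n + f (suc n) 0
conv-snoc f zero    = refl
conv-snoc f (suc n) =
  trans (cong (f 0 (suc (suc n)) +_) (conv-snoc (f ∘ suc) n))
        (sym (+-assoc (f 0 (suc (suc n))) _ _))

conv-flip : ∀ f n → conv (flip f) n ≡ conv f n
conv-flip f zero    = refl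
conv-flip f (suc n) =
  trans (cong (f (suc n) 0 +_) (conv-flip (λ i j → f i (suc j)) n))
        (trans (+-comm (f (suc n) 0) _) (sym (conv-snoc f n)))

-- Isolates the extreme terms: in the estimates below they are either the dominant ones or zero.
conv-peel : ∀ f n → conv f (2 + n) ≡
  f 0 (2 + n) + (conv (λ i j → f (suc i) (suc j)) n + f (2 + n) 0)
conv-peel f n = cong (f 0 (2 + n) +_) (conv-snoc (f ∘ suc) n)

conv-last : ∀ f n → f n 0 ≤ conv f n
conv-last f zero    = ≤-refl
conv-last f (suc n) = ≤-trans (conv-last (f ∘ suc) n) (m≤n+m _ _)

conv-bound : ∀ {f} b n → (∀ i j → i + j ≡ n → f i j ≤ b) → conv f n ≤ suc n * b
conv-bound b zero    e = ≤-trans (e 0 0 refl) (m≤m+n b 0)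
conv-bound b (suc n) e =
  +-mono-≤ (e 0 (suc n) refl) (conv-bound b n λ i j p → e (suc i) j (cong suc p))

pairs : ℕ → List (ℕ × ℕ)
pairs zero    = (0 , 0) ∷ []
pairs (suc n) = (0 , suc n) ∷ map (λ (i , j) → suc i , j) (pairs n)

pairs⁻ : ∀ {i j} n → (i , j) ∈ pairs n → i + j ≡ n
pairs⁻ zero    (here refl) = refl
pairs⁻ (suc n) (here refl) = refl
pairs⁻ (suc n) (there p∈) with (i , j) , p∈′ , refl ← ∈-map⁻ _ p∈ = cong suc (pairs⁻ n p∈′)

pairs⁺ : ∀ i j → (i , j) ∈ pairs (i + j)
pairs⁺ zero    zero    = here refl
pairs⁺ zero    (suc j) = here refl
pairs⁺ (suc i) j       = there (∈-map⁺ _ (pairs⁺ i j))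

length-pairs : ∀ n → length (pairs n) ≡ suc n
length-pairs zero    = refl
length-pairs (suc n) = cong suc (trans (length-map _ (pairs n)) (length-pairs n))

pairs-distinct : ∀ n → AllPairs (_≢_ on proj₁) (pairs n)
pairs-distinct zero    = [] ∷ []
pairs-distinct (suc n) = All.map⁺ (All.tabulate λ _ ()) ∷
  AllPairs.map⁺ (AllPairs.map (λ ne → ne ∘ suc-injective) (pairs-distinct n))

sum-pairs : ∀ f n → sum (map (uncurry f) (pairs n)) ≡ conv f n
sum-pairs f zero    = +-identityʳ (f 0 0)
sum-pairs f (suc n) = cong (f 0 (suc n) +_)
  (trans (cong sum (sym (map-∘ (pairs n)))) (sum-pairs (f ∘ suc) n))

sum-const : ∀ {A : Set} k (xs : List A) → sum (map (λ _ → k) xs) ≡ length xs * k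
sum-const k []       = refl
sum-const k (x ∷ xs) = cong (k +_) (sum-const k xs)

module _ {A : Set} where

  sum-cong : ∀ {f g : A → ℕ} xs → (∀ {x} → x ∈ xs → f x ≡ g x) → sum (map f xs) ≡ sum (map g xs)
  sum-cong xs h = cong sum (map-cong-local (All.tabulate h))

  sum-suc : ∀ (f : A → ℕ) xs → sum (map (suc ∘ f) xs) ≡ length xs + sum (map f xs)
  sum-suc f []       = refl
  sum-suc f (x ∷ xs) = cong suc (trans (cong (f x +_) (sum-suc f xs)) (swap-front (f x) (length xs) _))
    where
    swap-front : ∀ a b c → a + (b + c) ≡ b + (a + c)
    swap-front = solve-∀

  sum-concatMap : ∀ {B : Set} (w : B → ℕ) (f : A → List B) xs →
    sum (map w (concatMap f xs)) ≡ sum (map (λ x → sum (map w (f x))) xs)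
  sum-concatMap w f []       = refl
  sum-concatMap w f (x ∷ xs) = trans (cong sum (map-++ w (f x) (concatMap f xs)))
    (trans (sum-++ (map w (f x)) _) (cong (sum (map w (f x)) +_) (sum-concatMap w f xs)))

  sum-cartesianProduct : ∀ {B : Set} (w : A → ℕ) xs (ys : List B) →
    sum (map (w ∘ proj₁) (cartesianProduct xs ys)) ≡ sum (map w xs) * length ys
  sum-cartesianProduct w []       ys = refl
  sum-cartesianProduct w (x ∷ xs) ys = begin
    sum (map (w ∘ proj₁) (map (x ,_) ys ++ cartesianProduct xs ys))
      ≡⟨ cong sum (map-++ _ (map (x ,_) ys) _) ⟩
    sum (map (w ∘ proj₁) (map (x ,_) ys) ++ map (w ∘ proj₁) (cartesianProduct xs ys))
      ≡⟨ sum-++ (map (w ∘ proj₁) (map (x ,_) ys)) _ ⟩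
    sum (map (w ∘ proj₁) (map (x ,_) ys)) + sum (map (w ∘ proj₁) (cartesianProduct xs ys))
      ≡⟨ cong₂ _+_ (trans (cong sum (sym (map-∘ ys))) (trans (sum-const (w x) ys) (*-comm (length ys) (w x))))
                   (sum-cartesianProduct w xs ys) ⟩
    w x * length ys + sum (map w xs) * length ys ≡⟨ *-distribʳ-+ (length ys) (w x) _ ⟨
    (w x + sum (map w xs)) * length ys ∎
    where open ≡-Reasoning

  map-unique : ∀ {B : Set} (f : A → B) {xs} →
    (∀ {x y} → x ∈ xs → y ∈ xs → f x ≡ f y → x ≡ y) → Unique xs → Unique (map f xs)
  map-unique f inj []       = []
  map-unique f inj (x∉ ∷ u) =
    All.map⁺ (All.tabulate λ y∈ e → All.lookup x∉ y∈ (inj (here refl) (there y∈) e))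
    ∷ map-unique f (λ x∈ y∈ → inj (there x∈) (there y∈)) u

map-range : ∀ h a b m → (∀ i → h (a + i) ≡ b + i) → map h (range a m) ≡ range b m
map-range h a b zero    e = refl
map-range h a b (suc m) e = cong₂ _∷_
  (trans (cong h (sym (+-identityʳ a))) (trans (e 0) (+-identityʳ b)))
  (map-range h (suc a) (suc b) m λ i →
    trans (cong h (sym (+-suc a i))) (trans (e (suc i)) (+-suc b i)))

-- Shifts by 1 to make room for the root and, beyond the first `g` points, by `m` more for the gap.
-- It is defined on all numbers so as to be strictly increasing everywhere, as `Relabel` requires.
toOuter : ℕ → ℕ → ℕ → ℕ
toOuter g m x with x ≤? g
... | yes _ = suc x
... | no _  = suc (m + x)

toOuter-low : ∀ g m x → x ≤ g → toOuter g m x ≡ suc x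
toOuter-low g m x x≤g with x ≤? g
... | yes _  = refl
... | no x≰g = ⊥-elim (x≰g x≤g)

toOuter-high : ∀ g m x → g < x → toOuter g m x ≡ suc (m + x)
toOuter-high g m x g<x with x ≤? g
... | yes x≤g = ⊥-elim (<⇒≱ g<x x≤g)
... | no _    = refl

toOuter-mono : ∀ g m {x y} → x < y → toOuter g m x < toOuter g m y
toOuter-mono g m {x} {y} x<y with x ≤? g | y ≤? g
... | yes _  | yes _   = s≤s x<y
... | yes _  | no _    = s≤s (≤-trans x<y (m≤n+m y m))
... | no x≰g | yes y≤g = ⊥-elim (x≰g (≤-trans (<⇒≤ x<y) y≤g))
... | no _   | no _    = s≤s (+-monoʳ-< m x<y)

map-toOuter : ∀ g m e → map (toOuter g m) (range 1 (g + e)) ≡ outer g m e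
map-toOuter g m e = begin
  map (toOuter g m) (range 1 (g + e)) ≡⟨ cong (map (toOuter g m)) (range-++ 1 g e) ⟩
  map (toOuter g m) (range 1 g ++ range (1 + g) e) ≡⟨ map-++ (toOuter g m) (range 1 g) (range (1 + g) e) ⟩
  map (toOuter g m) (range 1 g) ++ map (toOuter g m) (range (1 + g) e) ≡⟨ cong₂ _++_ low high ⟩
  outer g m e ∎
  where
  open ≡-Reasoning
  low : map (toOuter g m) (range 1 g) ≡ range 2 g
  low = trans (map-cong-local (All.tabulate λ {x} x∈ → toOuter-low g m x (≤-pred (proj₂ (range⁻ 1 g x∈)))))
              (map-range suc 1 2 g (λ _ → refl))
  arith : ∀ g m i → suc (m + (1 + g + i)) ≡ 2 + g + m + i
  arith = solve-∀
  high : map (toOuter g m) (range (1 + g) e) ≡ range (2 + g + m) e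
  high = trans (map-cong-local (All.tabulate λ {x} x∈ → toOuter-high g m x (proj₁ (range⁻ (1 + g) e x∈))))
               (map-range (λ x → suc (m + x)) (1 + g) (2 + g + m) e (arith g m))

-- Keeps the first point 1 and moves the others past the `g` points of `A` that follow it.
toInner : ℕ → ℕ → ℕ
toInner g (suc (suc x)) = 2 + g + x
toInner g x             = x

toInner-mono : ∀ g {x y} → x < y → toInner g x < toInner g y
toInner-mono g {zero}        {suc zero}    _ = s≤s z≤n
toInner-mono g {zero}        {suc (suc y)} _ = s≤s z≤n
toInner-mono g {suc zero}    {suc zero}    (s≤s ())
toInner-mono g {suc zero}    {suc (suc y)} _ = s≤s (s≤s z≤n)
toInner-mono g {suc (suc x)} {suc (suc y)} (s≤s (s≤s x<y)) = s≤s (s≤s (+-monoʳ-< g x<y))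
toInner-mono g {suc (suc x)} {suc zero}    (s≤s ())

map-toInner : ∀ g m → map (toInner g) (range 1 (1 + m)) ≡ inner g m
map-toInner g m = cong (1 ∷_) (map-range (toInner g) 2 (2 + g) m (λ _ → refl))

connectedDiagrams≡ : ∀ n → connectedDiagrams n ≡ connectedMatchings n (range 1 (2 * n))
connectedDiagrams≡ n = cong (connectedMatchings n)
  (trans (map-applyUpTo id suc (2 * n)) (applyUpTo≡range suc 1 (2 * n) (λ _ → refl)))
  where
  applyUpTo≡range : ∀ f a m → (∀ i → f i ≡ a + i) → applyUpTo f m ≡ range a m
  applyUpTo≡range f a zero    e = refl
  applyUpTo≡range f a (suc m) e = cong₂ _∷_ (trans (e 0) (+-identityʳ a))
    (applyUpTo≡range (f ∘ suc) (suc a) m (λ i → trans (e (suc i)) (+-suc a i)))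

connectedMatchings⁻ : ∀ n xs {D} → AllPairs _<_ xs → D ∈ connectedMatchings n xs →
  length D ≡ n × IsMatching xs D × T (connected D)
connectedMatchings⁻ n xs s D∈ with D∈′ , c ← ∈-filter⁻ (T? ∘ connected) {xs = matchings n xs} D∈ =
  let l , p = matchings⁻ n xs s D∈′ in l , p , c

connectedMatchings⁺ : ∀ n xs {D} → AllPairs _<_ xs → length D ≡ n → IsMatching xs D → T (connected D) →
  D ∈ connectedMatchings n xs
connectedMatchings⁺ n xs s l p c = ∈-filter⁺ (T? ∘ connected) (matchings⁺ n xs s l p) c

connectedMatchings-unique : ∀ n xs → AllPairs _<_ xs → Unique (connectedMatchings n xs)
connectedMatchings-unique n xs s = Unique.filter⁺ (T? ∘ connected) (matchings-unique n xs s)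

-- The index is one less than the number of chords: both pieces are nonempty, so sums over 1 ≤ k ≤ n
-- - 1 become sums over all pairs with a fixed sum.
count weight : ℕ → ℕ
count i  = length (connectedDiagrams (suc i))
weight i = sum (map firstTerminal (connectedDiagrams (suc i)))

length-outer-matchings : ∀ i g m e → g + e ≡ 2 * suc i →
  length (connectedMatchings (suc i) (outer g m e)) ≡ count i
length-outer-matchings i g m e eq = begin
  length (connectedMatchings (suc i) (outer g m e))
    ≡⟨ cong (length ∘ connectedMatchings (suc i)) (map-toOuter g m e) ⟨
  length (connectedMatchings (suc i) (map (toOuter g m) (range 1 (g + e))))
    ≡⟨ Relabel.length-connectedMatchings-relabel (toOuter g m) (toOuter-mono g m) (suc i) (range 1 (g + e)) ⟩
  length (connectedMatchings (suc i) (range 1 (g + e)))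
    ≡⟨ cong (length ∘ connectedMatchings (suc i) ∘ range 1) eq ⟩
  length (connectedMatchings (suc i) (range 1 (2 * suc i)))
    ≡⟨ cong length (connectedDiagrams≡ (suc i)) ⟨
  count i ∎
  where open ≡-Reasoning

weight-outer-matchings : ∀ i g m e → g + e ≡ 2 * suc i →
  sum (map firstTerminal (connectedMatchings (suc i) (outer g m e))) ≡ weight i
weight-outer-matchings i g m e eq = begin
  total (outer g m e) ≡⟨ cong total (map-toOuter g m e) ⟨
  total (map (toOuter g m) (range 1 (g + e)))
    ≡⟨ Relabel.sum-firstTerminal-relabel (toOuter g m) (toOuter-mono g m) (suc i) (range 1 (g + e)) ⟩
  total (range 1 (g + e)) ≡⟨ cong (total ∘ range 1) eq ⟩
  total (range 1 (2 * suc i)) ≡⟨ cong (sum ∘ map firstTerminal) (connectedDiagrams≡ (suc i)) ⟨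
  weight i ∎
  where
  open ≡-Reasoning
  total : List ℕ → ℕ
  total xs = sum (map firstTerminal (connectedMatchings (suc i) xs))

length-inner-matchings : ∀ j g → length (connectedMatchings (suc j) (inner g (1 + 2 * j))) ≡ count j
length-inner-matchings j g = begin
  length (connectedMatchings (suc j) (inner g (1 + 2 * j)))
    ≡⟨ cong (length ∘ connectedMatchings (suc j)) (map-toInner g (1 + 2 * j)) ⟨
  length (connectedMatchings (suc j) (map (toInner g) (range 1 (2 + 2 * j))))
    ≡⟨ Relabel.length-connectedMatchings-relabel (toInner g) (toInner-mono g) (suc j) (range 1 (2 + 2 * j)) ⟩
  length (connectedMatchings (suc j) (range 1 (2 + 2 * j)))
    ≡⟨ cong (length ∘ connectedMatchings (suc j) ∘ range 1) (double-suc j) ⟨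
  length (connectedMatchings (suc j) (range 1 (2 * suc j)))
    ≡⟨ cong length (connectedDiagrams≡ (suc j)) ⟨
  count j ∎
  where
  open ≡-Reasoning
  double-suc : ∀ j → 2 * suc j ≡ 2 + 2 * j
  double-suc = solve-∀

-- Pairs of pieces, arranged by their sizes and the position of the gap.

cell : ℕ → ℕ → ℕ → ℕ → List (Diagram × Diagram)
cell i j g e = cartesianProduct (connectedMatchings (suc i) (outer (suc g) (1 + 2 * j) (suc e)))
                                (connectedMatchings (suc j) (inner (suc g) (1 + 2 * j)))

-- `A` has 2(i + 1) points, `suc g` before the gap and `suc e` after it, so `g + e` is 2i and the
-- pairs run through the 2i + 1 inner gaps. Of the 2(j + 1) points of `C` all but the first lie in
-- the gap, hence its width `1 + 2 * j`.
row : ℕ → ℕ → List (Diagram × Diagram)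
row i j = concatMap (λ (g , e) → cell i j g e) (pairs (2 * i))

pieces : ℕ → List (Diagram × Diagram)
pieces n = concatMap (λ (i , j) → row i j) (pairs n)

record Piece (n : ℕ) (A C : Diagram) : Set where
  field
    {i j g e} : ℕ
    i+j≡n  : i + j ≡ n
    g+e≡2i : g + e ≡ 2 * i
    A∈     : A ∈ connectedMatchings (suc i) (outer (suc g) (1 + 2 * j) (suc e))
    C∈     : C ∈ connectedMatchings (suc j) (inner (suc g) (1 + 2 * j))

row⁻ : ∀ {i j A C} → (A , C) ∈ row i j → ∃[ g ] ∃[ e ] g + e ≡ 2 * i × (A , C) ∈ cell i j g e
row⁻ {i} {j} p∈ with (g , e) , ge∈ , q ← find (∈-concatMap⁻ _ {xs = pairs (2 * i)} p∈) =
  g , e , pairs⁻ (2 * i) ge∈ , q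

pieces⁻ : ∀ {n A C} → (A , C) ∈ pieces n → Piece n A C
pieces⁻ {n} p∈ with (i , j) , ij∈ , q ← find (∈-concatMap⁻ _ {xs = pairs n} p∈)
  with g , e , ge , q′ ← row⁻ {i} {j} q
  with A∈ , C∈ ← ∈-cartesianProduct⁻ (connectedMatchings (suc i) (outer (suc g) (1 + 2 * j) (suc e)))
                   (connectedMatchings (suc j) (inner (suc g) (1 + 2 * j))) q′ =
  record { i = i ; j = j ; g = g ; e = e ; i+j≡n = pairs⁻ n ij∈ ; g+e≡2i = ge ; A∈ = A∈ ; C∈ = C∈ }

pieces⁺ : ∀ {n A C} → Piece n A C → (A , C) ∈ pieces n
pieces⁺ record { i = i ; j = j ; g = g ; e = e ; i+j≡n = refl ; g+e≡2i = ge ; A∈ = A∈ ; C∈ = C∈ } =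
  ∈-concatMap⁺ _ (lose (pairs⁺ i j) (∈-concatMap⁺ _
    (lose (subst (λ k → (g , e) ∈ pairs k) ge (pairs⁺ g e)) (∈-cartesianProduct⁺ A∈ C∈))))

-- One computation serves both recurrences: `w` is constantly 1 for `count-suc` and `firstTerminal`
-- for `weight-suc`. Weighing only the first piece is enough because the index of a join depends on
-- `A` alone.
module _ (w : Diagram → ℕ) (W : ℕ → ℕ)
  (w-outer : ∀ i g m e → g + e ≡ 2 * suc i →
    sum (map w (connectedMatchings (suc i) (outer g m e))) ≡ W i) where

  sum-row : ∀ i j → sum (map (w ∘ proj₁) (row i j)) ≡ (1 + 2 * i) * (W i * count j)
  sum-row i j = begin
    sum (map (w ∘ proj₁) (row i j)) ≡⟨ sum-concatMap (w ∘ proj₁) _ (pairs (2 * i)) ⟩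
    sum (map (λ (g , e) → sum (map (w ∘ proj₁) (cell i j g e))) (pairs (2 * i)))
      ≡⟨ sum-cong (pairs (2 * i)) (λ {(g , e)} ge∈ → trans
           (sum-cartesianProduct w (connectedMatchings (suc i) (outer (suc g) (1 + 2 * j) (suc e))) _)
           (cong₂ _*_ (w-outer i (suc g) (1 + 2 * j) (suc e) (lengths g e (pairs⁻ (2 * i) ge∈)))
                      (length-inner-matchings j (suc g)))) ⟩
    sum (map (λ _ → W i * count j) (pairs (2 * i))) ≡⟨ sum-const (W i * count j) (pairs (2 * i)) ⟩
    length (pairs (2 * i)) * (W i * count j) ≡⟨ cong (_* (W i * count j)) (length-pairs (2 * i)) ⟩
    (1 + 2 * i) * (W i * count j) ∎
    where
    open ≡-Reasoning
    lengths : ∀ g e → g + e ≡ 2 * i → suc g + suc e ≡ 2 * suc i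
    lengths g e eq = cong suc (trans (+-suc g e) (trans (cong suc eq) (sym (+-suc i (i + 0)))))

  sum-pieces : ∀ n → sum (map (w ∘ proj₁) (pieces n)) ≡ conv (λ i j → (1 + 2 * i) * (W i * count j)) n
  sum-pieces n = begin
    sum (map (w ∘ proj₁) (pieces n)) ≡⟨ sum-concatMap (w ∘ proj₁) _ (pairs n) ⟩
    sum (map (λ (i , j) → sum (map (w ∘ proj₁) (row i j))) (pairs n))
      ≡⟨ cong sum (map-cong (λ (i , j) → sum-row i j) (pairs n)) ⟩
    sum (map (λ (i , j) → (1 + 2 * i) * (W i * count j)) (pairs n))
      ≡⟨ sum-pairs (λ i j → (1 + 2 * i) * (W i * count j)) n ⟩
    conv (λ i j → (1 + 2 * i) * (W i * count j)) n ∎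
    where open ≡-Reasoning

-- The length of `A` separates the rows, and the position of its gap separates the cells of a row.
pieces-unique : ∀ n → Unique (pieces n)
pieces-unique n = concatMap-unique _ (pairs n) (λ {(i , j)} _ → row-unique i j)
  (AllPairs.map (λ {p} {q} ne {v} → rows-disjoint {p} {q} ne {v}) (pairs-distinct n))
  where
  outer-matching : ∀ {i j g e A C} → (A , C) ∈ cell i j g e →
    length A ≡ suc i × IsMatching (outer (suc g) (1 + 2 * j) (suc e)) A × T (connected A)
  outer-matching {i} {j} {g} {e} p∈ = connectedMatchings⁻ (suc i) _ (outer-increasing (suc g) (1 + 2 * j) (suc e))
    (proj₁ (∈-cartesianProduct⁻ (connectedMatchings (suc i) (outer (suc g) (1 + 2 * j) (suc e))) _ p∈))
  -- The point 2 + g would be a point of `A` by the second matching, but by the first it lies in the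
  -- gap, which is nonempty.
  not< : ∀ {g g′ m e e′ A} → IsMatching (outer g (suc m) e) A → IsMatching (outer g′ (suc m) e′) A → ¬ g < g′
  not< {g} {g′} {m} {e} {e′} p q g<g′ with outer⁻ g (suc m) e (∈-resp-↭ (perm p) (∈-resp-↭ (↭-sym (perm q))
      (∈-++⁺ˡ (range⁺ 2 g′ (s≤s (s≤s (z≤n {g}))) (s≤s (s≤s g<g′))))))
  ... | _ , inj₁ l , _ = <-irrefl refl l
  ... | _ , inj₂ l , _ = <⇒≱ (m<m+n (2 + g) (s≤s z≤n)) l
  row-unique : ∀ i j → Unique (row i j)
  row-unique i j = concatMap-unique _ (pairs (2 * i))
    (λ {(g , e)} _ → Unique.cartesianProduct⁺
      (connectedMatchings-unique (suc i) _ (outer-increasing (suc g) (1 + 2 * j) (suc e)))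
      (connectedMatchings-unique (suc j) _ (inner-increasing (suc g) (1 + 2 * j))))
    (AllPairs.map (λ {p} {q} ne {v} → cells-disjoint {p} {q} ne {v}) (pairs-distinct (2 * i)))
    where
    cells-disjoint : ∀ {p q : ℕ × ℕ} → proj₁ p ≢ proj₁ q → Disjoint (uncurry (cell i j) p) (uncurry (cell i j) q)
    cells-disjoint {g , e} {g′ , e′} ne (p∈ , q∈)
      with _ , p , _ ← outer-matching {i} {j} {g} {e} p∈ | _ , q , _ ← outer-matching {i} {j} {g′} {e′} q∈ =
      ne (suc-injective (≤-antisym (≮⇒≥ (not< q p)) (≮⇒≥ (not< p q))))
  rows-disjoint : ∀ {p q : ℕ × ℕ} → proj₁ p ≢ proj₁ q → Disjoint (uncurry row p) (uncurry row q)
  rows-disjoint {i , j} {i′ , j′} ne (p∈ , q∈)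
    with g , e , _ , p ← row⁻ {i} {j} p∈ | g′ , e′ , _ , q ← row⁻ {i′} {j′} q∈ =
    ne (suc-injective (trans (sym (proj₁ (outer-matching {i} {j} {g} {e} p)))
                             (proj₁ (outer-matching {i′} {j′} {g′} {e′} q))))

-- Collects the hypotheses of `Join` with the heads exposed and the separate sizes forgotten, so
-- that pairs of different sizes can be compared in `join-injective`.
record Joinable (n : ℕ) (A C : Diagram) : Set where
  field
    {d r}   : Chord
    {A′ C′} : Diagram
    {g m e} : ℕ
    A≡   : A ≡ d ∷ A′
    C≡   : C ≡ r ∷ C′
    1≤g  : 1 ≤ g
    1≤e  : 1 ≤ e
    size : 1 + g + m + e ≡ 2 * (2 + n)
    len  : length A + length C ≡ 2 + n
    mA   : IsMatching (outer g m e) (d ∷ A′)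
    mC   : IsMatching (inner g m) (r ∷ C′)
    cA   : T (connected (d ∷ A′))
    cC   : T (connected (r ∷ C′))

piece⇒joinable : ∀ {n A C} → Piece n A C → Joinable n A C
piece⇒joinable {n} {A} {C} record { i = i ; j = j ; g = g ; e = e ; i+j≡n = refl ; g+e≡2i = ge ; A∈ = A∈ ; C∈ = C∈ }
  with connectedMatchings⁻ (suc i) _ (outer-increasing (suc g) (1 + 2 * j) (suc e)) A∈
     | connectedMatchings⁻ (suc j) _ (inner-increasing (suc g) (1 + 2 * j)) C∈
piece⇒joinable {A = d ∷ A} {C = r ∷ C} record { i = i ; j = j ; g = g ; e = e ; i+j≡n = refl ; g+e≡2i = ge }
  | lA , mA , cA | lC , mC , cC = record
  { A≡ = refl ; C≡ = refl ; 1≤g = s≤s z≤n ; 1≤e = s≤s z≤n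
  ; size = trans (arith₁ g e j) (trans (cong (λ z → z + 2 * j + 4) ge) (arith₂ i j))
  ; len = trans (cong₂ _+_ lA lC) (cong suc (+-suc i j))
  ; mA = mA ; mC = mC ; cA = cA ; cC = cC }
  where
  arith₁ : ∀ g e j → 1 + suc g + (1 + 2 * j) + suc e ≡ (g + e) + 2 * j + 4
  arith₁ = solve-∀
  arith₂ : ∀ i j → 2 * i + 2 * j + 4 ≡ 2 * (2 + (i + j))
  arith₂ = solve-∀

join∈connectedDiagrams : ∀ {n A C} → Joinable n A C → join A C ∈ connectedDiagrams (2 + n)
join∈connectedDiagrams {n} record { d = d ; r = r ; A′ = A ; C′ = C ; A≡ = refl ; C≡ = refl
  ; 1≤g = 1≤g ; 1≤e = 1≤e ; size = size ; len = len
  ; mA = mA ; mC = mC ; cA = cA ; cC = cC } =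
  subst (join (d ∷ A) (r ∷ C) ∈_) (sym (connectedDiagrams≡ (2 + n)))
    (connectedMatchings⁺ (2 + n) (range 1 (2 * (2 + n))) (range-increasing 1 (2 * (2 + n)))
      (trans (↭-length (join-↭ (d ∷ A) (r ∷ C))) (trans (length-++ (d ∷ A)) len))
      (subst (λ k → IsMatching (range 1 k) (join (d ∷ A) (r ∷ C))) size J.join-matching)
      J.join-connected)
  where module J = Join 1≤g 1≤e mA mC cA cC

firstTerminal-joinable : ∀ {n A C} → Joinable n A C → firstTerminal (join A C) ≡ suc (firstTerminal A)
firstTerminal-joinable record { A≡ = refl ; C≡ = refl ; 1≤g = 1≤g ; 1≤e = 1≤e
  ; mA = mA ; mC = mC ; cA = cA ; cC = cC } = Join.firstTerminal-join 1≤g 1≤e mA mC cA cC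

firstComponent : Diagram → Diagram
firstComponent (r ∷ d ∷ Z) = component (d ∷ Z) d
firstComponent _           = []

firstComponent-join : ∀ {n A C} → Joinable n A C → firstComponent (join A C) ≡ A
firstComponent-join record { r = r ; A≡ = refl ; C≡ = refl ; 1≤g = 1≤g ; 1≤e = 1≤e
  ; mA = mA ; mC = mC ; cA = cA ; cC = cC } with Z , eq ← Join.D-head 1≤g 1≤e mA mC cA cC =
  trans (cong firstComponent (trans J.join≡ (cong (r ∷_) eq))) (J.component-join eq)
  where module J = Join 1≤g 1≤e mA mC cA cC

joinable-rest : ∀ {n A C} → Joinable n A C → Sorted C × (∀ {x} → x ∈ A → x ∉ C)
joinable-rest record { A≡ = refl ; C≡ = refl ; 1≤g = 1≤g ; 1≤e = 1≤e
  ; mA = mA ; mC = mC ; cA = cA ; cC = cC } = sorted mC , Join.A∩C 1≤g 1≤e mA mC cA cC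

-- `A` is recovered from the join as the first component without the root, and `C` as the complement
-- of `A`, the two being disjoint.
join-injective : ∀ {n A C A′ C′} → Joinable n A C → Joinable n A′ C′ → join A C ≡ join A′ C′ →
  (A , C) ≡ (A′ , C′)
join-injective {A = A} {C} {A′} {C′} p q eq
  with trans (sym (firstComponent-join p)) (trans (cong firstComponent eq) (firstComponent-join q))
... | refl with sC , disjoint ← joinable-rest p | sC′ , disjoint′ ← joinable-rest q =
  cong (A ,_) (sorted-ext sC sC′
    (λ x∈ → [ (λ x∈A → ⊥-elim (disjoint x∈A x∈)) , id ]′ (join⁻ A C′ (subst (_ ∈_) eq (join⁺ʳ A C x∈))))
    (λ x∈ → [ (λ x∈A → ⊥-elim (disjoint′ x∈A x∈)) , id ]′ (join⁻ A C (subst (_ ∈_) (sym eq) (join⁺ʳ A C′ x∈)))))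

-- Counting the points of each matching shows that the gap has odd width `1 + 2 * length C` and that
-- `g + e` is twice the length of the tail of the first piece.
decomposition⇒piece : ∀ {n D} → length D ≡ 2 + n → Decomposition (2 * (2 + n)) D →
  ∃[ A ] ∃[ C ] Piece n A C × join A C ≡ D
decomposition⇒piece l record { g = suc g ; m = m ; e = suc e ; d = d′ ; r = r′ ; A = A ; C = C
                             ; mA = mA ; mC = mC ; cA = cA ; cC = cC ; join≡ = eq } =
  d′ ∷ A , r′ ∷ C , record
    { i = length A ; j = length C ; g = g ; e = e
    ; i+j≡n = suc-injective (suc-injective (trans (cong suc (sym (+-suc (length A) (length C))))
        (trans (sym (length-++ (d′ ∷ A))) (trans (sym (↭-length (join-↭ (d′ ∷ A) (r′ ∷ C))))
          (trans (cong length eq) l)))))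
    ; g+e≡2i = outer-length
    ; A∈ = connectedMatchings⁺ (suc (length A)) _ (outer-increasing (suc g) (1 + 2 * length C) (suc e)) refl
             (subst (λ m → IsMatching (outer (suc g) m (suc e)) (d′ ∷ A)) m≡ mA) cA
    ; C∈ = connectedMatchings⁺ (suc (length C)) _ (inner-increasing (suc g) (1 + 2 * length C)) refl
             (subst (λ m → IsMatching (inner (suc g) m) (r′ ∷ C)) m≡ mC) cC
    } , eq
  where
  m≡ : m ≡ 1 + 2 * length C
  m≡ = suc-injective (begin
    suc m ≡⟨ cong suc (length-range (2 + suc g) m) ⟨
    length (inner (suc g) m) ≡⟨ ↭-length (perm mC) ⟨
    length (points (r′ ∷ C)) ≡⟨ length-points (r′ ∷ C) ⟩
    2 * suc (length C) ≡⟨ cong suc (+-suc (length C) (length C + 0)) ⟩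
    2 + 2 * length C ∎)
    where open ≡-Reasoning
  outer-length : g + e ≡ 2 * length A
  outer-length = suc-injective (suc-injective (begin
    2 + (g + e) ≡⟨ cong suc (+-suc g e) ⟨
    suc g + suc e ≡⟨ cong₂ _+_ (length-range 2 (suc g)) (length-range (2 + suc g + m) (suc e)) ⟨
    length (range 2 (suc g)) + length (range (2 + suc g + m) (suc e)) ≡⟨ length-++ (range 2 (suc g)) ⟨
    length (outer (suc g) m (suc e)) ≡⟨ ↭-length (perm mA) ⟨
    length (points (d′ ∷ A)) ≡⟨ length-points (d′ ∷ A) ⟩
    2 * suc (length A) ≡⟨ cong suc (+-suc (length A) (length A + 0)) ⟩
    2 + 2 * length A ∎))
    where open ≡-Reasoning

connectedDiagrams⇒piece : ∀ {n D} → D ∈ connectedDiagrams (2 + n) →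
  ∃[ A ] ∃[ C ] Piece n A C × join A C ≡ D
connectedDiagrams⇒piece {n} {D} D∈ = go D (connectedMatchings⁻ (2 + n) (range 1 (2 * (2 + n)))
  (range-increasing 1 (2 * (2 + n))) (subst (D ∈_) (connectedDiagrams≡ (2 + n)) D∈))
  where
  go : ∀ D → length D ≡ 2 + n × IsMatching (range 1 (2 * (2 + n))) D × T (connected D) →
    ∃[ A ] ∃[ C ] Piece n A C × join A C ≡ D
  go (r ∷ d ∷ Z) (l , mD , cD) = decomposition⇒piece l (Split.decomposition mD cD)

-- The bijection behind the recurrences. Both lists are free of repetitions, so two inclusions
-- suffice: one is `Split`, the other `Join`.
connectedDiagrams↭joins : ∀ n → connectedDiagrams (2 + n) ↭ map (uncurry join) (pieces n)
connectedDiagrams↭joins n = unique∧sets⇒↭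
  (subst Unique (sym (connectedDiagrams≡ (2 + n)))
    (connectedMatchings-unique (2 + n) _ (range-increasing 1 (2 * (2 + n)))))
  (map-unique (uncurry join) (λ x∈ y∈ → join-injective (joinable x∈) (joinable y∈)) (pieces-unique n))
  (λ D∈ → let A , C , p , eq = connectedDiagrams⇒piece {n} D∈ in
    subst (_∈ map (uncurry join) (pieces n)) eq (∈-map⁺ (uncurry join) (pieces⁺ {n} p)))
  (λ D∈ → let (A , C) , p , eq = ∈-map⁻ (uncurry join) D∈ in
    subst (_∈ connectedDiagrams (2 + n)) (sym eq) (join∈connectedDiagrams (joinable p)))
  where
  joinable : ∀ {A C} → (A , C) ∈ pieces n → Joinable n A C
  joinable = piece⇒joinable ∘ pieces⁻

count-suc : ∀ n → count (suc n) ≡ conv (λ i j → (1 + 2 * i) * (count i * count j)) n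
count-suc n = begin
  count (suc n) ≡⟨ ↭-length (connectedDiagrams↭joins n) ⟩
  length (map (uncurry join) (pieces n)) ≡⟨ length-map (uncurry join) (pieces n) ⟩
  length (pieces n) ≡⟨ length≡sum (pieces n) ⟩
  sum (map (λ _ → 1) (pieces n)) ≡⟨ sum-pieces (λ _ → 1) count (λ i g m e eq →
    trans (sym (length≡sum (connectedMatchings (suc i) (outer g m e)))) (length-outer-matchings i g m e eq)) n ⟩
  conv (λ i j → (1 + 2 * i) * (count i * count j)) n ∎
  where
  open ≡-Reasoning
  length≡sum : ∀ {A : Set} (xs : List A) → length xs ≡ sum (map (λ _ → 1) xs)
  length≡sum xs = trans (sym (*-identityʳ (length xs))) (sym (sum-const 1 xs))

weight-suc : ∀ n → weight (suc n) ≡ count (suc n) + conv (λ i j → (1 + 2 * i) * (weight i * count j)) n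
weight-suc n = begin
  weight (suc n) ≡⟨ sum-↭ (↭-map⁺ firstTerminal (connectedDiagrams↭joins n)) ⟩
  sum (map firstTerminal (map (uncurry join) (pieces n))) ≡⟨ cong sum (map-∘ (pieces n)) ⟨
  sum (map (firstTerminal ∘ uncurry join) (pieces n))
    ≡⟨ sum-cong (pieces n) (λ p∈ → firstTerminal-joinable (piece⇒joinable (pieces⁻ {n} p∈))) ⟩
  sum (map (suc ∘ firstTerminal ∘ proj₁) (pieces n)) ≡⟨ sum-suc (firstTerminal ∘ proj₁) (pieces n) ⟩
  length (pieces n) + sum (map (firstTerminal ∘ proj₁) (pieces n))
    ≡⟨ cong₂ _+_
         (trans (sym (length-map (uncurry join) (pieces n))) (sym (↭-length (connectedDiagrams↭joins n))))
         (sum-pieces firstTerminal weight weight-outer-matchings n) ⟩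
  count (suc n) + conv (λ i j → (1 + 2 * i) * (weight i * count j)) n ∎
  where open ≡-Reasoning

-- Asymptotics of the recurrences

-- C i and T i stand for c_(i+1) and t_(i+1).
module Recurrence
  (C T : ℕ → ℕ)
  (C-zero : C 0 ≡ 1)
  (T-zero : T 0 ≡ 1)
  (C-suc : ∀ n → C (suc n) ≡ conv (λ i j → (1 + 2 * i) * (C i * C j)) n)
  (T-suc : ∀ n → T (suc n) ≡ C (suc n) + conv (λ i j → (1 + 2 * i) * (T i * C j)) n)
  where

  open ≤-Reasoning

  -- `Q` and `R` make up the error term. `S′` and `S` arise from splitting 2 + n as (1 + i) + (1 +
  -- j) in the main term.
  Q R S S′ : ℕ → ℕ
  Q = conv (λ i j → C i * C j)
  R = conv (λ i j → (i * j) * (C i * C j))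
  S = conv (λ i j → ((1 + 2 * i) * suc j) * (C i * C j))
  S′ = conv (λ i j → ((1 + 2 * i) * suc i) * (C i * C j))

  private
    I : ℕ → ℕ
    I = conv (λ i j → i * (C i * C j))

    J≡I : ∀ n → conv (λ i j → j * (C i * C j)) n ≡ I n
    J≡I n = trans (conv-cong n λ i j _ → cong (j *_) (*-comm (C i) (C j)))
                  (conv-flip (λ i j → i * (C i * C j)) n)

    C-suc-I : ∀ n → C (suc n) ≡ Q n + 2 * I n
    C-suc-I n = begin-equality
      C (suc n) ≡⟨ C-suc n ⟩
      conv (λ i j → (1 + 2 * i) * (C i * C j)) n
        ≡⟨ conv-cong n (λ i j _ → split i (C i * C j)) ⟩
      conv (λ i j → C i * C j + 2 * (i * (C i * C j))) n
        ≡⟨ conv-+ _ _ n ⟩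
      Q n + conv (λ i j → 2 * (i * (C i * C j))) n
        ≡⟨ cong (Q n +_) (conv-* 2 _ n) ⟩
      Q n + 2 * I n ∎
      where
      split : ∀ i x → (1 + 2 * i) * x ≡ x + 2 * (i * x)
      split = solve-∀

  C-suc-Q : ∀ n → C (suc n) ≡ suc n * Q n
  C-suc-Q n = begin-equality
    C (suc n) ≡⟨ C-suc-I n ⟩
    Q n + 2 * I n ≡⟨ cong (λ z → Q n + (I n + z)) (+-identityʳ (I n)) ⟩
    Q n + (I n + I n) ≡⟨ cong (λ z → Q n + (I n + z)) (J≡I n) ⟨
    Q n + (I n + conv (λ i j → j * (C i * C j)) n) ≡⟨ cong (Q n +_) (conv-+ _ _ n) ⟨
    Q n + conv (λ i j → i * (C i * C j) + j * (C i * C j)) n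
      ≡⟨ cong (Q n +_) (conv-cong n λ i j p →
           trans (sym (*-distribʳ-+ (C i * C j) i j)) (cong (_* (C i * C j)) p)) ⟩
    Q n + conv (λ i j → n * (C i * C j)) n ≡⟨ cong (Q n +_) (conv-* n _ n) ⟩
    suc n * Q n ∎

  -- Expand (1 + 2i)(1 + j) = 2ij + 2i + j + 1, use that the weights i and j give equal sums, and
  -- compare with the weight 1 + 2i of C (suc n). This is the cancellation of 3 c_n.
  S-R-identity : ∀ n → 2 * S n + Q n ≡ 3 * C (suc n) + 4 * R n
  S-R-identity n = begin-equality
    2 * S n + Q n ≡⟨ cong (λ z → 2 * z + Q n) S-split ⟩
    2 * (2 * R n + (2 * I n + (I n + Q n))) + Q n ≡⟨ arith (R n) (I n) (Q n) ⟩
    3 * (Q n + 2 * I n) + 4 * R n ≡⟨ cong (λ z → 3 * z + 4 * R n) (C-suc-I n) ⟨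
    3 * C (suc n) + 4 * R n ∎
    where
    arith : ∀ r i q → 2 * (2 * r + (2 * i + (i + q))) + q ≡ 3 * (q + 2 * i) + 4 * r
    arith = solve-∀
    split : ∀ i j x → ((1 + 2 * i) * suc j) * x ≡
      2 * ((i * j) * x) + (2 * (i * x) + (j * x + x))
    split = solve-∀
    S-split : S n ≡ 2 * R n + (2 * I n + (I n + Q n))
    S-split =
      trans (conv-cong n λ i j _ → split i j (C i * C j))
      (trans (conv-+ _ _ n) (cong₂ _+_ (conv-* 2 _ n)
      (trans (conv-+ _ _ n) (cong₂ _+_ (conv-* 2 _ n)
      (trans (conv-+ _ _ n) (cong (_+ Q n) (J≡I n)))))))

  S′+S : ∀ n → S′ n + S n ≡ (2 + n) * C (suc n)
  S′+S n = begin-equality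
    S′ n + S n ≡⟨ conv-+ _ _ n ⟨
    conv (λ i j → ((1 + 2 * i) * suc i) * (C i * C j) + ((1 + 2 * i) * suc j) * (C i * C j)) n
      ≡⟨ conv-cong n (λ i j p → trans (combine i j (C i * C j))
           (cong (λ z → (2 + z) * ((1 + 2 * i) * (C i * C j))) p)) ⟩
    conv (λ i j → (2 + n) * ((1 + 2 * i) * (C i * C j))) n ≡⟨ conv-* (2 + n) _ n ⟩
    (2 + n) * conv (λ i j → (1 + 2 * i) * (C i * C j)) n ≡⟨ cong ((2 + n) *_) (C-suc n) ⟨
    (2 + n) * C (suc n) ∎
    where
    combine : ∀ i j x → ((1 + 2 * i) * suc i) * x + ((1 + 2 * i) * suc j) * x ≡
      (2 + (i + j)) * ((1 + 2 * i) * x)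
    combine = solve-∀

  C-one : C 1 ≡ 1
  C-one rewrite C-suc 0 | C-zero = refl
  C-two : C 2 ≡ 4
  C-two rewrite C-suc 1 | C-one | C-zero = refl
  C-three : C 3 ≡ 27
  C-three rewrite C-suc 2 | C-two | C-one | C-zero = refl
  C-four : C 4 ≡ 248
  C-four rewrite C-suc 3 | C-three | C-two | C-one | C-zero = refl

  -- Keeps only the two extreme terms of `Q`, each equal to `C (1 + n)` as `C 0` is 1. The index
  -- starts high enough for these to be different terms.
  C-lower : ∀ n → 2 * (2 + n) * C (1 + n) ≤ C (2 + n)
  C-lower n = begin
    2 * (2 + n) * C (1 + n) ≡⟨ arith n (C (1 + n)) ⟩
    (2 + n) * (1 * C (1 + n) + C (1 + n) * 1)
      ≡⟨ cong (λ z → (2 + n) * (z * C (1 + n) + C (1 + n) * z)) C-zero ⟨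
    (2 + n) * (C 0 * C (1 + n) + C (1 + n) * C 0)
      ≤⟨ *-monoʳ-≤ (2 + n) (+-monoʳ-≤ (C 0 * C (1 + n)) (conv-last _ n)) ⟩
    (2 + n) * Q (suc n) ≡⟨ C-suc-Q (suc n) ⟨
    C (2 + n) ∎
    where
    arith : ∀ n x → 2 * (2 + n) * x ≡ (2 + n) * (1 * x + x * 1)
    arith = solve-∀

  Upper : ℕ → Set
  Upper n = C (suc n) ≤ 2 * (2 + n) * C n

  -- C (a + 1) / C a ≤ 2 (a + 2) ≤ 2 (b + 1) ≤ C (b + 1) / C b
  C-swap : ∀ {a b} → Upper a → a < b → C (suc a) * C b ≤ C a * C (suc b)
  C-swap {a} {suc b} u a<b = begin
    C (suc a) * C (suc b) ≤⟨ *-monoˡ-≤ (C (suc b)) u ⟩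
    2 * (2 + a) * C a * C (suc b)
      ≤⟨ *-monoˡ-≤ (C (suc b)) (*-monoˡ-≤ (C a) (*-monoʳ-≤ 2 (s≤s a<b))) ⟩
    2 * (2 + b) * C a * C (suc b) ≡⟨ arith (2 * (2 + b)) (C a) (C (suc b)) ⟩
    C a * (2 * (2 + b) * C (suc b)) ≤⟨ *-monoʳ-≤ (C a) (C-lower b) ⟩
    C a * C (2 + b) ∎
    where
    arith : ∀ k x y → k * x * y ≡ x * (k * y)
    arith = solve-∀

  -- Each use of `C-swap` moves the indices one further apart at constant sum, until the smaller one
  -- is `m`. Upper bounds are assumed only below `m + a`, so that this can be used inside the
  -- induction proving them.
  C-slide : ∀ m a b → (∀ {i} → i < m + a → Upper i) → a ≤ b →
            C (m + a) * C (m + b) ≤ C m * C (m + (a + b))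
  C-slide m zero    b u _ rewrite +-identityʳ m = ≤-refl
  C-slide m (suc a) b u a<b rewrite +-suc m a | sym (+-suc a b) = begin
    C (suc (m + a)) * C (m + b) ≤⟨ C-swap (u (n<1+n _)) (+-monoʳ-< m a<b) ⟩
    C (m + a) * C (suc (m + b)) ≡⟨ cong (λ z → C (m + a) * C z) (+-suc m b) ⟨
    C (m + a) * C (m + suc b)
      ≤⟨ C-slide m a (suc b) (u ∘ m<n⇒m<1+n) (≤-trans (<⇒≤ a<b) (n≤1+n b)) ⟩
    C m * C (m + (a + suc b)) ∎

  C-slide′ : ∀ m n → (∀ {i} → i < m + n → Upper i) →
             ∀ a b → a + b ≡ n → C (m + a) * C (m + b) ≤ C m * C (m + n)
  C-slide′ m _ u a b refl with ≤-total a b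
  ... | inj₁ a≤b = C-slide m a b
    (λ i< → u (<-≤-trans i< (+-monoʳ-≤ m (m≤m+n a b)))) a≤b
  ... | inj₂ b≤a rewrite *-comm (C (m + a)) (C (m + b)) | +-comm a b =
    C-slide m b a (λ i< → u (<-≤-trans i< (+-monoʳ-≤ m (m≤m+n b a)))) b≤a

  -- The extreme terms of `Q` give 2(5 + p)z, so the rest has to fit into 2z. It consists of the
  -- next pair of terms, 2y, and `V`, whose p + 1 terms are at most 4x each by sliding; `C-lower`
  -- then trades x for y and y for z.
  upper-step : ∀ p → (∀ {i} → i < 4 + p → Upper i) → Upper (4 + p)
  upper-step p u = begin
    C (5 + p) ≡⟨ C-suc-Q (4 + p) ⟩
    (5 + p) * Q (4 + p) ≡⟨ cong ((5 + p) *_) (trans (conv-peel (λ i j → C i * C j) (2 + p))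
        (cong (λ v → C 0 * z + (v + z * C 0)) (conv-peel (λ i j → C (suc i) * C (suc j)) p))) ⟩
    (5 + p) * (C 0 * z + ((C 1 * y + (V + y * C 1)) + z * C 0))
      ≡⟨ cong₂ (λ c d → (5 + p) * (c * z + ((d * y + (V + y * d)) + z * c))) C-zero C-one ⟩
    (5 + p) * (1 * z + ((1 * y + (V + y * 1)) + z * 1)) ≡⟨ arith₁ p z y V ⟩
    2 * (5 + p) * z + (2 * (5 + p) * y + (5 + p) * V)
      ≤⟨ +-monoʳ-≤ (2 * (5 + p) * z) (begin
        2 * (5 + p) * y + (5 + p) * V ≤⟨ +-monoʳ-≤ (2 * (5 + p) * y) (*-monoʳ-≤ (5 + p) V≤) ⟩
        2 * (5 + p) * y + (5 + p) * (suc p * (4 * x))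
          -- Adding 16 completes the square: 4 (p + 1) (p + 5) + 16 = 4 (p + 3)^2.
          ≤⟨ +-monoʳ-≤ (2 * (5 + p) * y) (≤-trans (m≤m+n _ (16 * x)) (≤-reflexive (arith₂ p x))) ⟩
        2 * (5 + p) * y + (6 + 2 * p) * (2 * (3 + p) * x)
          ≤⟨ +-monoʳ-≤ (2 * (5 + p) * y) (*-monoʳ-≤ (6 + 2 * p) (C-lower (1 + p))) ⟩
        2 * (5 + p) * y + (6 + 2 * p) * y ≡⟨ arith₃ p y ⟩
        2 * (2 * (4 + p) * y) ≤⟨ *-monoʳ-≤ 2 (C-lower (2 + p)) ⟩
        2 * z ∎) ⟩
    2 * (5 + p) * z + 2 * z ≡⟨ arith₄ p z ⟩
    2 * (6 + p) * z ∎
    where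
    x = C (2 + p)
    y = C (3 + p)
    z = C (4 + p)
    V = conv (λ i j → C (2 + i) * C (2 + j)) p
    V≤ : V ≤ suc p * (4 * x)
    V≤ = conv-bound (4 * x) p λ i j e →
      ≤-trans (C-slide′ 2 p (λ i< → u (≤-trans i< (+-monoˡ-≤ p (s≤s (s≤s z≤n))))) i j e)
              (≤-reflexive (cong (_* x) C-two))
    arith₁ : ∀ p z y v → (5 + p) * (1 * z + ((1 * y + (v + y * 1)) + z * 1)) ≡
      2 * (5 + p) * z + (2 * (5 + p) * y + (5 + p) * v)
    arith₁ = solve-∀
    arith₂ : ∀ p x → (5 + p) * (suc p * (4 * x)) + 16 * x ≡ (6 + 2 * p) * (2 * (3 + p) * x)
    arith₂ = solve-∀
    arith₃ : ∀ p y → 2 * (5 + p) * y + (6 + 2 * p) * y ≡ 2 * (2 * (4 + p) * y)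
    arith₃ = solve-∀
    arith₄ : ∀ p z → 2 * (5 + p) * z + 2 * z ≡ 2 * (6 + p) * z
    arith₄ = solve-∀

  C-upper : ∀ n → Upper n
  C-upper = <-rec Upper induct
    where
    induct : ∀ n → (∀ {i} → i < n → Upper i) → Upper n
    induct 0 _ rewrite C-one | C-zero = s≤s z≤n
    induct 1 _ rewrite C-two | C-one = m≤m+n 4 2
    induct 2 _ rewrite C-three | C-two = m≤m+n 27 5
    induct 3 _ rewrite C-four | C-three = m≤m+n 248 22
    induct (suc (suc (suc (suc p)))) u = upper-step p u

  -- Dividing `C-upper` by n + 1 would give the factor 4. The factor 20 is the amount that `T-upper`
  -- has to spare.
  Q-bound : ∀ n → Q n ≤ 20 * C n
  Q-bound n = *-cancelˡ-≤ (suc n) (begin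
    suc n * Q n ≡⟨ C-suc-Q n ⟨
    C (suc n) ≤⟨ C-upper n ⟩
    2 * (2 + n) * C n ≤⟨ m≤m+n _ ((16 + 18 * n) * C n) ⟩
    2 * (2 + n) * C n + (16 + 18 * n) * C n ≡⟨ arith n (C n) ⟩
    suc n * (20 * C n) ∎)
    where
    arith : ∀ n x → 2 * (2 + n) * x + (16 + 18 * n) * x ≡ suc n * (20 * x)
    arith = solve-∀

  -- The extreme terms vanish, and in the others the weight ij is absorbed by raising both indices,
  -- since 2(i + 1) C (i + 1) ≤ C (i + 2). In the resulting sum the two extreme terms give 8z and
  -- the inner ones at most 14z, whence 22.
  R-bound : ∀ n → 4 * R n ≤ 22 * C n
  R-bound 0 = z≤n
  R-bound 1 = z≤n
  R-bound (suc (suc n)) = begin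
    4 * R (2 + n) ≡⟨ cong (4 *_) (trans (conv-peel (λ i j → (i * j) * (C i * C j)) n)
      (drop-ends n (C (2 + n)) (C 0) _)) ⟩
    4 * conv (λ i j → (suc i * suc j) * (C (suc i) * C (suc j))) n ≡⟨ conv-* 4 _ n ⟨
    conv (λ i j → 4 * ((suc i * suc j) * (C (suc i) * C (suc j)))) n
      ≤⟨ conv-mono n (λ i j _ → begin
           4 * ((suc i * suc j) * (C (suc i) * C (suc j)))
             ≡⟨ spread (suc i) (suc j) (C (suc i)) (C (suc j)) ⟩
           (2 * suc i * C (suc i)) * (2 * suc j * C (suc j))
             ≤⟨ *-mono-≤ (weaken i) (weaken j) ⟩
           C (2 + i) * C (2 + j) ∎) ⟩
    V n ≤⟨ V-bound n ⟩
    22 * C (2 + n) ∎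
    where
    V : ℕ → ℕ
    V = conv (λ i j → C (2 + i) * C (2 + j))
    drop-ends : ∀ n x y v → 0 + (v + ((2 + n) * 0) * (x * y)) ≡ v
    drop-ends = solve-∀
    spread : ∀ i j x y → 4 * ((i * j) * (x * y)) ≡ (2 * i * x) * (2 * j * y)
    spread = solve-∀
    weaken : ∀ i → 2 * suc i * C (suc i) ≤ C (2 + i)
    weaken i = ≤-trans (*-monoˡ-≤ (C (suc i)) (*-monoʳ-≤ 2 (n≤1+n (suc i)))) (C-lower i)
    V-bound : ∀ n → V n ≤ 22 * C (2 + n)
    V-bound 0 rewrite C-two = m≤m+n 16 72
    V-bound 1 rewrite C-three | C-two = m≤m+n 216 378
    V-bound (suc (suc p)) = begin
      V (2 + p) ≡⟨ conv-peel (λ i j → C (2 + i) * C (2 + j)) p ⟩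
      C 2 * z + (W + z * C 2) ≡⟨ cong (λ c → c * z + (W + z * c)) C-two ⟩
      4 * z + (W + z * 4) ≤⟨ +-monoʳ-≤ (4 * z) (+-monoˡ-≤ (z * 4) W≤) ⟩
      4 * z + (suc p * (27 * y) + z * 4)
        ≤⟨ +-monoʳ-≤ (4 * z) (+-monoˡ-≤ (z * 4)
             -- 27 (p + 1) is increased to 28 (p + 4), which is the factor of `C-lower` taken 14
             -- times.
             (≤-trans (m≤m+n _ ((85 + p) * y)) (≤-reflexive (arith₁ p y)))) ⟩
      4 * z + (14 * (2 * (4 + p) * y) + z * 4)
        ≤⟨ +-monoʳ-≤ (4 * z) (+-monoˡ-≤ (z * 4) (*-monoʳ-≤ 14 (C-lower (2 + p)))) ⟩
      4 * z + (14 * z + z * 4) ≡⟨ arith₂ z ⟩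
      22 * z ∎
      where
      y = C (3 + p)
      z = C (4 + p)
      W = conv (λ i j → C (3 + i) * C (3 + j)) p
      W≤ : W ≤ suc p * (27 * y)
      W≤ = conv-bound (27 * y) p λ i j e →
        ≤-trans (C-slide′ 3 p (λ _ → C-upper _) i j e) (≤-reflexive (cong (_* y) C-three))
      arith₁ : ∀ p y → suc p * (27 * y) + (85 + p) * y ≡ 14 * (2 * (4 + p) * y)
      arith₁ = solve-∀
      arith₂ : ∀ z → 4 * z + (14 * z + z * 4) ≡ 22 * z
      arith₂ = solve-∀

  private
    -- The indicator of i = 0, by which the error, a multiple of C n, is written as a convolution
    -- and compared term by term.
    δ : ℕ → ℕ
    δ zero    = 1
    δ (suc _) = 0

    δ-sum : ∀ n → conv (λ i j → δ i * (C i * C j)) n ≡ C n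
    δ-sum zero rewrite C-zero = refl
    δ-sum (suc n) = begin-equality
      1 * (C 0 * C (suc n)) + conv (λ _ _ → 0) n
        ≡⟨ cong₂ (λ c z → 1 * (c * C (suc n)) + z) C-zero (conv-* 0 (λ _ _ → 0) n) ⟩
      1 * (1 * C (suc n)) + 0 ≡⟨ arith (C (suc n)) ⟩
      C (suc n) ∎
      where
      arith : ∀ x → 1 * (1 * x) + 0 ≡ x
      arith = solve-∀

    T-sum : ∀ n → 3 * T (suc n) ≡
      3 * C (suc n) + conv (λ i j → (1 + 2 * i) * (3 * T i * C j)) n
    T-sum n = begin-equality
      3 * T (suc n) ≡⟨ cong (3 *_) (T-suc n) ⟩
      3 * (C (suc n) + conv (λ i j → (1 + 2 * i) * (T i * C j)) n) ≡⟨ *-distribˡ-+ 3 (C (suc n)) _ ⟩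
      3 * C (suc n) + 3 * conv (λ i j → (1 + 2 * i) * (T i * C j)) n
        ≡⟨ cong (3 * C (suc n) +_) (trans (sym (conv-* 3 _ n))
             (conv-cong n λ i j _ → arith (1 + 2 * i) (T i) (C j))) ⟩
      3 * C (suc n) + conv (λ i j → (1 + 2 * i) * (3 * T i * C j)) n ∎
      where
      arith : ∀ a t c → 3 * (a * (t * c)) ≡ a * (3 * t * c)
      arith = solve-∀

    -- The factor 1 + 2i is 1 where `δ` does not vanish, so the correction can be put under the
    -- common weight.
    δ-weight : ∀ i x → δ i * x ≡ (1 + 2 * i) * (δ i * x)
    δ-weight zero x = sym (*-identityˡ (1 * x))
    δ-weight (suc i) x = sym (*-zeroʳ (1 + 2 * suc i))

  -- Here 3 C (suc n) is bounded by 2 S + Q, dropping `R`, and the error is Q ≤ 20 C n. At i = 0 the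
  -- bound is 23 against the value 3, which spares exactly 20.
  T-upper : ∀ n → 3 * T n ≤ (2 * suc n + 21) * C n
  T-upper = <-rec _ induct
    where
    -- The weight of the term i = 0 is what absorbs the error of each step.
    slack : ∀ i → 3 * T i ≤ (2 * suc i + 21) * C i →
            3 * T i + 20 * (δ i * C i) ≤ (2 * suc i + 21) * C i
    slack zero    _ rewrite T-zero | C-zero = ≤-refl
    slack (suc i) h rewrite +-identityʳ (3 * T (suc i)) = h
    induct : ∀ n → (∀ {i} → i < n → 3 * T i ≤ (2 * suc i + 21) * C i) →
           3 * T n ≤ (2 * suc n + 21) * C n
    induct zero    _ rewrite T-zero | C-zero = m≤m+n 3 20
    induct (suc n) ih = +-cancelʳ-≤ (20 * C n) _ _ (begin
      3 * T (suc n) + 20 * C n ≡⟨ cong₂ (λ t c → t + 20 * c) (T-sum n) (sym (δ-sum n)) ⟩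
      3 * C (suc n) + X + 20 * conv (λ i j → δ i * (C i * C j)) n
        ≡⟨ cong (3 * C (suc n) + X +_) (conv-* 20 _ n) ⟨
      3 * C (suc n) + X + conv (λ i j → 20 * (δ i * (C i * C j))) n
        ≡⟨ +-assoc (3 * C (suc n)) X _ ⟩
      3 * C (suc n) + (X + conv (λ i j → 20 * (δ i * (C i * C j))) n)
        ≡⟨ cong (3 * C (suc n) +_) (conv-+ _ _ n) ⟨
      3 * C (suc n) + conv (λ i j → (1 + 2 * i) * (3 * T i * C j) + 20 * (δ i * (C i * C j))) n
        ≤⟨ +-monoʳ-≤ (3 * C (suc n)) (conv-mono n pointwise) ⟩
      3 * C (suc n) + conv (λ i j →
          2 * (((1 + 2 * i) * suc i) * (C i * C j)) + 21 * ((1 + 2 * i) * (C i * C j))) n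
        ≡⟨ cong (3 * C (suc n) +_) (trans (conv-+ _ _ n)
             (cong₂ _+_ (conv-* 2 _ n) (trans (conv-* 21 _ n) (cong (21 *_) (sym (C-suc n)))))) ⟩
      3 * C (suc n) + (2 * S′ n + 21 * C (suc n))
        ≤⟨ +-monoˡ-≤ (2 * S′ n + 21 * C (suc n)) (begin
             3 * C (suc n) ≤⟨ m≤m+n _ (4 * R n) ⟩
             3 * C (suc n) + 4 * R n ≡⟨ S-R-identity n ⟨
             2 * S n + Q n ≤⟨ +-monoʳ-≤ (2 * S n) (Q-bound n) ⟩
             2 * S n + 20 * C n ∎) ⟩
      2 * S n + 20 * C n + (2 * S′ n + 21 * C (suc n))
        ≡⟨ arith₁ (S n) (S′ n) (C n) (C (suc n)) ⟩
      2 * (S′ n + S n) + 21 * C (suc n) + 20 * C n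
        ≡⟨ cong (λ z → 2 * z + 21 * C (suc n) + 20 * C n) (S′+S n) ⟩
      2 * ((2 + n) * C (suc n)) + 21 * C (suc n) + 20 * C n
        ≡⟨ cong (_+ 20 * C n) (arith₂ n (C (suc n))) ⟩
      (2 * suc (suc n) + 21) * C (suc n) + 20 * C n ∎)
      where
      X = conv (λ i j → (1 + 2 * i) * (3 * T i * C j)) n
      arith₁ : ∀ s s′ c d → 2 * s + 20 * c + (2 * s′ + 21 * d) ≡ 2 * (s′ + s) + 21 * d + 20 * c
      arith₁ = solve-∀
      arith₂ : ∀ n d → 2 * ((2 + n) * d) + 21 * d ≡ (2 * suc (suc n) + 21) * d
      arith₂ = solve-∀
      arith₃ : ∀ a t d c → a * (t * c) + 20 * (a * (d * c)) ≡ a * ((t + 20 * d) * c)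
      arith₃ = solve-∀
      arith₄ : ∀ i x c → (1 + 2 * i) * ((2 * suc i + 21) * x * c) ≡
        2 * (((1 + 2 * i) * suc i) * (x * c)) + 21 * ((1 + 2 * i) * (x * c))
      arith₄ = solve-∀
      pointwise : ∀ i j → i + j ≡ n →
        (1 + 2 * i) * (3 * T i * C j) + 20 * (δ i * (C i * C j)) ≤
        2 * (((1 + 2 * i) * suc i) * (C i * C j)) + 21 * ((1 + 2 * i) * (C i * C j))
      pointwise i j e = begin
        (1 + 2 * i) * (3 * T i * C j) + 20 * (δ i * (C i * C j))
          ≡⟨ cong (λ z → (1 + 2 * i) * (3 * T i * C j) + 20 * z)
               (trans (δ-weight i _) (cong ((1 + 2 * i) *_) (sym (*-assoc (δ i) (C i) (C j))))) ⟩
        (1 + 2 * i) * (3 * T i * C j) + 20 * ((1 + 2 * i) * (δ i * C i * C j))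
          ≡⟨ arith₃ (1 + 2 * i) (3 * T i) (δ i * C i) (C j) ⟩
        (1 + 2 * i) * ((3 * T i + 20 * (δ i * C i)) * C j)
          ≤⟨ *-monoʳ-≤ (1 + 2 * i) (*-monoˡ-≤ (C j)
               (slack i (ih (s≤s (≤-trans (m≤m+n i j) (≤-reflexive e)))))) ⟩
        (1 + 2 * i) * ((2 * suc i + 21) * C i * C j) ≡⟨ arith₄ i (C i) (C j) ⟩
        2 * (((1 + 2 * i) * suc i) * (C i * C j)) + 21 * ((1 + 2 * i) * (C i * C j)) ∎

  -- The mirror image: now `Q` is dropped and 4 R ≤ 22 C n is the error. At i = 0 the inequality
  -- reads 2 ≤ 24, which spares exactly 22.
  T-lower : ∀ n → 2 * suc n * C n ≤ 3 * T n + 21 * C n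
  T-lower = <-rec _ induct
    where
    slack : ∀ i → 2 * suc i * C i ≤ 3 * T i + 21 * C i →
            2 * suc i * C i + 22 * (δ i * C i) ≤ 3 * T i + 21 * C i
    slack zero    _ rewrite T-zero | C-zero = ≤-refl
    slack (suc i) h rewrite +-identityʳ (2 * suc (suc i) * C (suc i)) = h
    induct : ∀ n → (∀ {i} → i < n → 2 * suc i * C i ≤ 3 * T i + 21 * C i) →
           2 * suc n * C n ≤ 3 * T n + 21 * C n
    induct zero    _ rewrite T-zero | C-zero = m≤m+n 2 22
    induct (suc n) ih = begin
      2 * suc (suc n) * C (suc n) ≡⟨ *-assoc 2 (2 + n) (C (suc n)) ⟩
      2 * ((2 + n) * C (suc n)) ≡⟨ cong (2 *_) (S′+S n) ⟨
      2 * (S′ n + S n) ≡⟨ *-distribˡ-+ 2 (S′ n) (S n) ⟩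
      2 * S′ n + 2 * S n
        ≤⟨ +-monoʳ-≤ (2 * S′ n) (begin
             2 * S n ≤⟨ m≤m+n _ (Q n) ⟩
             2 * S n + Q n ≡⟨ S-R-identity n ⟩
             3 * C (suc n) + 4 * R n ≤⟨ +-monoʳ-≤ (3 * C (suc n)) (R-bound n) ⟩
             3 * C (suc n) + 22 * C n ∎) ⟩
      2 * S′ n + (3 * C (suc n) + 22 * C n) ≡⟨ arith₁ (S′ n) (C (suc n)) (C n) ⟩
      3 * C (suc n) + (2 * S′ n + 22 * C n)
        ≡⟨ cong (λ z → 3 * C (suc n) + (2 * S′ n + 22 * z)) (δ-sum n) ⟨
      3 * C (suc n) + (2 * S′ n + 22 * conv (λ i j → δ i * (C i * C j)) n)
        ≡⟨ cong (3 * C (suc n) +_) (trans (conv-+ _ _ n)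
             (cong₂ _+_ (conv-* 2 _ n) (conv-* 22 _ n))) ⟨
      3 * C (suc n) + conv (λ i j →
          2 * (((1 + 2 * i) * suc i) * (C i * C j)) + 22 * (δ i * (C i * C j))) n
        ≤⟨ +-monoʳ-≤ (3 * C (suc n)) (conv-mono n pointwise) ⟩
      3 * C (suc n) + conv (λ i j →
          (1 + 2 * i) * (3 * T i * C j) + 21 * ((1 + 2 * i) * (C i * C j))) n
        ≡⟨ cong (3 * C (suc n) +_) (trans (conv-+ _ _ n)
             (cong (X +_) (trans (conv-* 21 _ n) (cong (21 *_) (sym (C-suc n)))))) ⟩
      3 * C (suc n) + (X + 21 * C (suc n)) ≡⟨ +-assoc (3 * C (suc n)) X _ ⟨
      3 * C (suc n) + X + 21 * C (suc n) ≡⟨ cong (_+ 21 * C (suc n)) (T-sum n) ⟨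
      3 * T (suc n) + 21 * C (suc n) ∎
      where
      X = conv (λ i j → (1 + 2 * i) * (3 * T i * C j)) n
      arith₁ : ∀ s d c → 2 * s + (3 * d + 22 * c) ≡ 3 * d + (2 * s + 22 * c)
      arith₁ = solve-∀
      arith₂ : ∀ i x d c → 2 * (((1 + 2 * i) * suc i) * (x * c)) + 22 * ((1 + 2 * i) * (d * c)) ≡
        (1 + 2 * i) * ((2 * suc i * x + 22 * d) * c)
      arith₂ = solve-∀
      arith₃ : ∀ a t x c → a * ((t + 21 * x) * c) ≡ a * (t * c) + 21 * (a * (x * c))
      arith₃ = solve-∀
      pointwise : ∀ i j → i + j ≡ n →
        2 * (((1 + 2 * i) * suc i) * (C i * C j)) + 22 * (δ i * (C i * C j)) ≤
        (1 + 2 * i) * (3 * T i * C j) + 21 * ((1 + 2 * i) * (C i * C j))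
      pointwise i j e = begin
        2 * (((1 + 2 * i) * suc i) * (C i * C j)) + 22 * (δ i * (C i * C j))
          ≡⟨ cong (λ z → 2 * (((1 + 2 * i) * suc i) * (C i * C j)) + 22 * z)
               (trans (δ-weight i _) (cong ((1 + 2 * i) *_) (sym (*-assoc (δ i) (C i) (C j))))) ⟩
        2 * (((1 + 2 * i) * suc i) * (C i * C j)) + 22 * ((1 + 2 * i) * (δ i * C i * C j))
          ≡⟨ arith₂ i (C i) (δ i * C i) (C j) ⟩
        (1 + 2 * i) * ((2 * suc i * C i + 22 * (δ i * C i)) * C j)
          ≤⟨ *-monoʳ-≤ (1 + 2 * i) (*-monoˡ-≤ (C j)
               (slack i (ih (s≤s (≤-trans (m≤m+n i j) (≤-reflexive e)))))) ⟩
        (1 + 2 * i) * ((3 * T i + 21 * C i) * C j) ≡⟨ arith₃ (1 + 2 * i) (3 * T i) (C i) (C j) ⟩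
        (1 + 2 * i) * (3 * T i * C j) + 21 * ((1 + 2 * i) * (C i * C j)) ∎

  C-positive : ∀ n → 1 ≤ C n
  C-positive zero = ≤-reflexive (sym C-zero)
  C-positive (suc zero) = ≤-reflexive (sym C-one)
  C-positive (suc (suc n)) = ≤-trans (*-mono-≤ {1} {2 * (2 + n)} (s≤s z≤n) (C-positive (suc n))) (C-lower n)

-- From bounds on natural numbers to the limit in the rationals.

x+y-x≡y : ∀ x y → x Q.+ y Q.- x ≡ y
x+y-x≡y x y = trans (cong (Q._- x) (Q.+-comm x y)) (trans (Q.+-assoc y x (Q.- x))
  (trans (cong (y Q.+_) (Q.+-inverseʳ x)) (Q.+-identityʳ y)))

∣x-1∣<ε : ∀ {x ε} → x Q.< 1ℚ Q.+ ε → 1ℚ Q.< x Q.+ ε → Q.∣ x Q.- 1ℚ ∣ Q.< ε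
∣x-1∣<ε {x} {ε} x<1+ε 1<x+ε with Q.∣p∣≡p∨∣p∣≡-p (x Q.- 1ℚ)
... | inj₁ e = subst (Q._< ε) (sym e)
  (subst (x Q.- 1ℚ Q.<_) (x+y-x≡y 1ℚ ε) (Q.+-monoˡ-< (Q.- 1ℚ) x<1+ε))
... | inj₂ e = subst (Q._< ε) (sym (trans e flipped))
  (subst (1ℚ Q.- x Q.<_) (x+y-x≡y x ε) (Q.+-monoˡ-< (Q.- x) 1<x+ε))
  where
  flipped : Q.- (x Q.- 1ℚ) ≡ 1ℚ Q.- x
  flipped = trans (Q.neg-distrib-+ x (Q.- 1ℚ)) (Q.+-comm (Q.- x) 1ℚ)

-- The two bounds put 3t/(cd) within M/d of 1. With q the denominator of ε, M q < d makes this less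
-- than 1/q, which is at most ε because a positive numerator is at least 1.
ratio-product-near-1 : ∀ ε → 0ℚ Q.< ε → ∀ {t c d M} → 1 ≤ c → M * Q.↧ₙ ε < d →
  3 * t ≤ (d + M) * c → d * c ≤ 3 * t + M * c →
  Q.∣ ratio t c Q.* ratio 3 d Q.- 1ℚ ∣ Q.< ε
ratio-product-near-1 (Q.mkℚ ℤ.+0 _ _) (Q.*<* (ℤ.+<+ ()))
ratio-product-near-1 (Q.mkℚ ℤ.-[1+ _ ] _ _) (Q.*<* ())
ratio-product-near-1 ε@(Q.mkℚ (ℤ.+[1+ p ]) q-1 _) _ {t} {suc c′} {suc d′} {M} _ Mq<d t≤ ≤t =
  ∣x-1∣<ε (Q.toℚᵘ-cancel-< (Qᵘ.<-respˡ-≃ (Qᵘ.≃-sym x≃) (Qᵘ.<-respʳ-≃ (Qᵘ.≃-sym 1+ε≃)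
            (Qᵘ.*<* (subst₂ ℤ._<_ upperˡ upperʳ (ℤ.+<+ upper))))))
          (Q.toℚᵘ-cancel-< (Qᵘ.<-respʳ-≃ (Qᵘ.≃-sym x+ε≃)
            (Qᵘ.*<* (subst₂ ℤ._<_ lowerˡ lowerʳ (ℤ.+<+ lower)))))
  where
  open import Data.Integer using (+_)
  c = suc c′
  d = suc d′
  q = suc q-1
  x = ratio t c Q.* ratio 3 d
  -- With unnormalised fractions no common factors are cancelled, and the order is plain
  -- cross-multiplication.
  xᵘ = Qᵘ.mkℚᵘ (+ t) c′ Qᵘ.* Qᵘ.mkℚᵘ (+ 3) d′
  x≃ : Q.toℚᵘ x Qᵘ.≃ xᵘ
  x≃ = Qᵘ.≃-trans (Q.toℚᵘ-homo-* (ratio t c) (ratio 3 d))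
    (Qᵘ.*-cong (Q.toℚᵘ-fromℚᵘ (Qᵘ.mkℚᵘ (+ t) c′)) (Q.toℚᵘ-fromℚᵘ (Qᵘ.mkℚᵘ (+ 3) d′)))
  1+ε≃ : Q.toℚᵘ (1ℚ Q.+ ε) Qᵘ.≃ Q.toℚᵘ 1ℚ Qᵘ.+ Q.toℚᵘ ε
  1+ε≃ = Q.toℚᵘ-homo-+ 1ℚ ε
  x+ε≃ : Q.toℚᵘ (x Q.+ ε) Qᵘ.≃ xᵘ Qᵘ.+ Q.toℚᵘ ε
  x+ε≃ = Qᵘ.≃-trans (Q.toℚᵘ-homo-+ x ε) (Qᵘ.+-congˡ (Q.toℚᵘ ε) x≃)
  open ≤-Reasoning
  small : M * c * q < suc p * (c * d)
  small = begin-strict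
    M * c * q ≡⟨ arith M c q ⟩
    c * (M * q) <⟨ *-monoʳ-< c Mq<d ⟩
    c * d ≤⟨ m≤m+n (c * d) (p * (c * d)) ⟩
    suc p * (c * d) ∎
    where
    arith : ∀ M c q → M * c * q ≡ c * (M * q)
    arith = solve-∀
  upper : (t * 3) * (1 * q) < (1 * q + suc p * 1) * (c * d)
  upper = begin-strict
    (t * 3) * (1 * q) ≡⟨ arith₁ t q ⟩
    3 * t * q ≤⟨ *-monoˡ-≤ q t≤ ⟩
    (d + M) * c * q ≡⟨ arith₂ d M c q ⟩
    d * c * q + M * c * q <⟨ +-monoʳ-< (d * c * q) small ⟩
    d * c * q + suc p * (c * d) ≡⟨ arith₃ d c q (suc p) ⟩
    (1 * q + suc p * 1) * (c * d) ∎
    where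
    arith₁ : ∀ t q → (t * 3) * (1 * q) ≡ 3 * t * q
    arith₁ = solve-∀
    arith₂ : ∀ d M c q → (d + M) * c * q ≡ d * c * q + M * c * q
    arith₂ = solve-∀
    arith₃ : ∀ d c q p → d * c * q + p * (c * d) ≡ (1 * q + p * 1) * (c * d)
    arith₃ = solve-∀
  lower : 1 * ((c * d) * q) < ((t * 3) * q + suc p * (c * d)) * 1
  lower = begin-strict
    1 * ((c * d) * q) ≡⟨ arith₁ c d q ⟩
    d * c * q ≤⟨ *-monoˡ-≤ q ≤t ⟩
    (3 * t + M * c) * q ≡⟨ *-distribʳ-+ q (3 * t) (M * c) ⟩
    3 * t * q + M * c * q <⟨ +-monoʳ-< (3 * t * q) small ⟩
    3 * t * q + suc p * (c * d) ≡⟨ arith₂ t q (suc p * (c * d)) ⟩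
    ((t * 3) * q + suc p * (c * d)) * 1 ∎
    where
    arith₁ : ∀ c d q → 1 * ((c * d) * q) ≡ d * c * q
    arith₁ = solve-∀
    arith₂ : ∀ t q z → 3 * t * q + z ≡ ((t * 3) * q + z) * 1
    arith₂ = solve-∀
  upperˡ : + ((t * 3) * (1 * q)) ≡ (+ t ℤ.* + 3) ℤ.* + (1 * q)
  upperˡ = trans (ℤ.pos-* (t * 3) (1 * q)) (cong (ℤ._* + (1 * q)) (ℤ.pos-* t 3))
  upperʳ : + ((1 * q + suc p * 1) * (c * d)) ≡ (+ 1 ℤ.* + q ℤ.+ + suc p ℤ.* + 1) ℤ.* + (c * d)
  upperʳ = trans (ℤ.pos-* (1 * q + suc p * 1) (c * d))
    (cong (ℤ._* + (c * d)) (cong₂ ℤ._+_ (ℤ.pos-* 1 q) (ℤ.pos-* (suc p) 1)))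
  lowerˡ : + (1 * ((c * d) * q)) ≡ + 1 ℤ.* + ((c * d) * q)
  lowerˡ = ℤ.pos-* 1 ((c * d) * q)
  lowerʳ : + (((t * 3) * q + suc p * (c * d)) * 1) ≡
    ((+ t ℤ.* + 3) ℤ.* + q ℤ.+ + suc p ℤ.* + (c * d)) ℤ.* + 1
  lowerʳ = trans (ℤ.pos-* ((t * 3) * q + suc p * (c * d)) 1) (cong (ℤ._* + 1)
    (cong₂ ℤ._+_ (trans (ℤ.pos-* (t * 3) q) (cong (ℤ._* + q) (ℤ.pos-* t 3)))
      (ℤ.pos-* (suc p) (c * d))))

theorem4p8 : (ε : ℚ) → 0ℚ Q.< ε →
    ∃[ N ] ((n : ℕ) → N ≤ n →
    Q.∣ expectedFirstTerminal n Q.* ratio 3 (2 * n) Q.- 1ℚ ∣ Q.< ε)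
-- The constant 21 is the one in `T-upper` and `T-lower`; n > 21 q gives 2n > 21 q. The successor
-- excludes n = 0, and n chords correspond to the index n - 1 of `weight` and `count`.
theorem4p8 ε 0<ε = suc (21 * Q.↧ₙ ε) , λ { (suc n) N≤n →
  ratio-product-near-1 ε 0<ε {t = weight n} (C-positive n)
    (≤-trans N≤n (m≤m+n (suc n) (1 * suc n))) (T-upper n) (T-lower n) }
  where open Recurrence count weight refl refl count-suc weight-suc using (T-upper; T-lower; C-positive)
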